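{- Let $a$ and $b$ be positive integers. Then there exists a 4-GDD of type $(3a)^4 (6a)^1 (3b)^1$ if and only if $a \le b \le 2a$.
   Context: A 4-GDD (group divisible design with block size 4) of type $g_1^{u_1} g_2^{u_2}\cdots g_r^{u_r}$ is a triple $(V,\mathcal{G},\mathcal{B})$ where $V$ is a finite set of $u_1g_1+\dots+u_rg_r$ points, $\mathcal{G}$ is a partition of $V$ into subsets called groups, exactly $u_i$ of which have cardinality $g_i$, and $\mathcal{B}$ is a non-empty collection of 4-element subsets of $V$ (blocks) such that every pair of points from distinct groups occurs in exactly one block and no pair of points from the same group occurs in any block. (Types are multisets of group sizes; e.g. $(3a)^4(6a)^1(3b)^1$ has four groups of size $3a$, one of size $6a$, one of size $3b$.) -}

module Defs where

open import Data.Nat using (ℕ; suc; _≤_; _*_)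
open import Data.Fin using (Fin; _≟_)
open import Data.Nat.ListAction using (sum)
open import Data.List using (List; []; _∷_; map; length; filter; allFin)
open import Data.List.Relation.Binary.Permutation.Propositional using (_↭_)
open import Data.Product using (Σ; ∃; _×_)
open import Relation.Binary.PropositionalEquality using (_≡_; _≢_)

record GDD4 (type : List ℕ) : Set where
  field
    numGroups : ℕ
    group     : Fin (sum type) → Fin numGroups
    numBlocks : ℕ
    block     : Fin numBlocks → Fin 4 → Fin (sum type)

  groupSize : Fin numGroups → ℕ
  groupSize j = length (filter (λ x → group x ≟ j) (allFin (sum type)))

  _∈B_ : Fin (sum type) → Fin numBlocks → Set
  x ∈B i = ∃ λ k → block i k ≡ x

  field
    -- the multiset of group sizes is exactly `type` (this also makes every group nonempty
    -- when all entries of `type` are positive)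
    groupType  : map groupSize (allFin numGroups) ↭ type
    nonEmpty   : 1 ≤ numBlocks
    -- the four entries of a block lie in pairwise distinct groups
    -- (so they are 4 distinct points and no same-group pair is in a block)
    blockTransversal : ∀ i k l → k ≢ l → group (block i k) ≢ group (block i l)
    pairCover  : ∀ x y → group x ≢ group y →
                 Σ (Fin numBlocks) λ i → (x ∈B i × y ∈B i) ×
                   (∀ j → x ∈B j → y ∈B j → j ≡ i)

typeThm : ℕ → ℕ → List ℕ
typeThm a b = 3 * a ∷ 3 * a ∷ 3 * a ∷ 3 * a ∷ 6 * a ∷ 3 * b ∷ []

{-# OPTIONS --safe #-}

-- Necessity: if x is a point and m a group not containing x, then the blocks joining x to the
-- points of m are distinct and meet outside the group of x in three points each, so that
-- 3 |m| + |group of x| is at most the number of points. Taking x in a group of size 3a and m of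
-- size 6a gives a ≤ b; taking x in the group of size 6a and m of size 3b gives b ≤ 2a.
--
-- Sufficiency: let a transversal design TD(6, t) be given. Replacing each of its points by 3a
-- points, except that those of the fifth group get 6a and the j-th point of the sixth group gets
-- 3βⱼ points, and each block by a design of type (3a)⁴ (6a)¹ (3βⱼ)¹, settles t a for all b, as Σ βⱼ
-- takes every value in [t a, 2 t a] when the βⱼ range over [a, 2a]. There is a TD(6, t) for t prime
-- to 6 (lines over ℤ/t) and for t = 8, 9, 12 (difference matrices). Dividing out 8, 9 and 12 as
-- often as possible leaves a = t r with t prime to 6 and r ∈ {1, 2, 3, 4, 6}, and for these r
-- the designs are developed from base blocks modulo 3r (found by computer; the case r = b = 1 comes
-- from a Kirkman triple system of order 15).
module Submission where

open import Defs
open import Data.Fin using (Fin; zero; suc; toℕ; fromℕ<; _≟_; splitAt; join; remQuot; combine; punchIn; punchOut; _↑ˡ_; _↑ʳ_)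
open import Data.Fin.Patterns using (0F; 1F; 2F; 3F; 4F; 5F)
open import Data.Fin.Properties using (all?; any?; *↔×; injective⇒≤; join-splitAt; splitAt-↑ˡ; splitAt-↑ʳ; combine-remQuot; punchIn-injective; punchInᵢ≢i; punchOut-injective; toℕ<n; toℕ-fromℕ<; toℕ-injective)
open import Data.List using (List; []; _∷_; length; filter; allFin; lookup; cartesianProduct; replicate)
open import Data.List.Membership.Propositional using (_∈_)
open import Data.List.Membership.Propositional.Properties using (∈-filter⁺; ∈-filter⁻; ∈-allFin; ∈-lookup; ∈-cartesianProduct⁺; ∈-cartesianProduct⁻)
open import Data.List.Properties using (map-cong; ∷-injectiveˡ; ∷-injectiveʳ)
open import Data.List.Relation.Binary.Permutation.Propositional using (↭-reflexive; ↭⇒↭ₛ)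
open import Data.List.Relation.Binary.Permutation.Propositional.Properties using (↭-map-inv)
open import Data.List.Relation.Binary.Permutation.Setoid.Properties using (Unique-resp-↭)
open import Data.List.Relation.Unary.All as All using ([]; _∷_)
open import Data.List.Relation.Unary.AllPairs using ([]; _∷_)
open import Data.List.Relation.Unary.Any using (here; index)
open import Data.List.Relation.Unary.Any.Properties using (lookup-index)
open import Data.List.Relation.Unary.Unique.Propositional using (Unique)
import Data.List.Relation.Unary.Unique.Propositional.Properties as Unique
open import Data.Nat using (ℕ; zero; suc; _+_; _*_; _∸_; _⊓_; _≤_; _<_; z≤n; s≤s; NonZero; >-nonZero; ≢-nonZero; ≢-nonZero⁻¹)
open import Data.Nat.Coprimality using (Coprime; coprime-divisor)
open import Data.Nat.Divisibility using (_∣_; _∤_; _∣?_; divides; divides-refl; ∣⇒≤; >⇒∤; 0∣⇒≡0; ∣-reflexive; ∣-trans; *-monoˡ-∣; m%n≡0⇒n∣m)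
open import Data.Nat.DivMod using (_/_; _%_; _mod_; %-distribˡ-+; [m+kn]%n≡m%n; m*n%n≡0; m%n<n; m%n%n≡m%n; m<n⇒m%n≡m; m∣n⇒o%n%m≡o%m)
open import Data.Nat.Induction using (<-rec)
open import Data.Nat.ListAction using (sum)
open import Data.Nat.Properties as ℕ using (module ≤-Reasoning)
open import Data.Nat.Tactic.RingSolver using (solve-∀)
open import Data.Product using (Σ; ∃; ∃₂; _×_; _,_; proj₁; proj₂)
open import Data.Product.Function.Dependent.Propositional using (Σ-↔)
open import Data.Sum using (_⊎_; inj₁; inj₂)
open import Data.Vec as Vec using (Vec; []; _∷_)
open import Function using (_∘_)
open import Function.Bundles using (_⇔_; mk⇔; _↔_; mk↔ₛ′; Inverse; Injection)
open import Function.Construct.Composition using (_↔-∘_)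
open import Function.Construct.Identity using (↔-id)
open import Function.Construct.Symmetry using (↔-sym)
open import Function.Definitions using (Injective)
open import Function.Properties.Inverse using (↔⇒↣)
open import Relation.Binary using (tri<; tri≈; tri>)
open import Relation.Binary.PropositionalEquality using (_≡_; _≢_; refl; sym; trans; cong; cong₂; subst; setoid)
open import Relation.Nullary using (Dec; yes; no; contradiction; ¬?)
open import Relation.Nullary.Decidable using (True; toWitness; _×-dec_; _⊎-dec_; _→-dec_)

open Inverse using (to; from; strictlyInverseˡ; strictlyInverseʳ)

-- Necessity: counting points on the blocks through a fixed point.

lookup-injective : {A : Set} {xs : List A} → Unique xs → Injective _≡_ _≡_ (lookup xs)
lookup-injective (x∉ ∷ _) {zero}  {zero}  _  = refl
lookup-injective (x∉ ∷ _) {zero}  {suc j} eq = contradiction eq (All.lookup x∉ (∈-lookup j))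
lookup-injective (x∉ ∷ _) {suc i} {zero}  eq = contradiction (sym eq) (All.lookup x∉ (∈-lookup i))
lookup-injective (_ ∷ u)  {suc i} {suc j} eq = cong suc (lookup-injective u eq)

module _ {type : List ℕ} (D : GDD4 type) where
  open GDD4 D

  members : Fin numGroups → List (Fin (sum type))
  members j = filter (λ x → group x ≟ j) (allFin (sum type))

  member : ∀ j → Fin (groupSize j) → Fin (sum type)
  member j = lookup (members j)

  group-member : ∀ j u → group (member j u) ≡ j
  group-member j u =
    proj₂ (∈-filter⁻ (λ x → group x ≟ j) {xs = allFin (sum type)} (∈-lookup {xs = members j} u))

  member-injective : ∀ j → Injective _≡_ _≡_ (member j)
  member-injective j = lookup-injective (Unique.filter⁺ (λ x → group x ≟ j) (Unique.allFin⁺ (sum type)))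

  same-position : ∀ {i k l} → group (block i k) ≡ group (block i l) → k ≡ l
  same-position {i} {k} {l} eq with k ≟ l
  ... | yes k≡l = k≡l
  ... | no  k≢l = contradiction eq (blockTransversal i k l k≢l)

  -- The pairs (position, point `u` of `m`) index the points other than `x` on the blocks joining
  -- `x` to `m`. If two such pairs name one point, that point and `x` lie in a single block, so the
  -- blocks agree, and then `u` and the position agree as well. None of these points is in the group
  -- of `x`, so the members of that group can be added to the count.
  group-bound : ∀ x m → group x ≢ m → 3 * groupSize m + groupSize (group x) ≤ sum type
  group-bound x m x∉m = injective⇒≤ {f = f ∘ splitAt (3 * groupSize m)} λ eq →
      splitAt-injective (f-injective (splitAt (3 * groupSize m) _) (splitAt (3 * groupSize m) _) eq)
    where
    h = group x

    splitAt-injective : ∀ {k n} {i j : Fin (k + n)} → splitAt k i ≡ splitAt k j → i ≡ j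
    splitAt-injective {k} {n} {i} {j} eq =
      trans (sym (join-splitAt k n i)) (trans (cong (join k n) eq) (join-splitAt k n j))

    remQuot-injective : ∀ {k n} {i j : Fin (k * n)} → remQuot {k} n i ≡ remQuot n j → i ≡ j
    remQuot-injective {k} {n} {i} {j} eq =
      trans (sym (combine-remQuot {k} n i))
            (trans (cong (λ (p , q) → combine p q) eq) (combine-remQuot {k} n j))

    apart : ∀ u → group x ≢ group (member m u)
    apart u eq = x∉m (trans eq (group-member m u))

    joining : ∀ u → Σ (Fin numBlocks) λ i → (x ∈B i × member m u ∈B i) ×
                (∀ j → x ∈B j → member m u ∈B j → j ≡ i)
    joining u = pairCover x (member m u) (apart u)

    blk : Fin (groupSize m) → Fin numBlocks
    blk u = proj₁ (joining u)

    pos : Fin (groupSize m) → Fin 4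
    pos u = proj₁ (proj₁ (proj₁ (proj₂ (joining u))))

    block-pos : ∀ u → block (blk u) (pos u) ≡ x
    block-pos u = proj₂ (proj₁ (proj₁ (proj₂ (joining u))))

    -- A block is transversal, hence meets the group `m` in at most one point.
    blk-injective : ∀ u v → blk u ≡ blk v → u ≡ v
    blk-injective u v eq with joining u | joining v
    blk-injective u v refl | i , (_ , k , p) , _ | .i , (_ , l , q) , _ =
      member-injective m (trans (sym p) (trans (cong (block i) k≡l) q))
      where
      k≡l : k ≡ l
      k≡l = same-position (trans (cong group p)
              (trans (group-member m u) (sym (trans (cong group q) (group-member m v)))))

    other : Fin 3 × Fin (groupSize m) → Fin (sum type)
    other (c , u) = block (blk u) (punchIn (pos u) c)

    other-apart : ∀ c u → group (other (c , u)) ≢ h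
    other-apart c u eq = punchInᵢ≢i (pos u) c
      (same-position (trans eq (cong group (sym (block-pos u)))))

    same-block : ∀ c u d v → other (c , u) ≡ other (d , v) → blk u ≡ blk v
    same-block c u d v eq =
        trans (unique (blk u) (pos u , block-pos u) (_ , refl))
              (sym (unique (blk v) (pos v , block-pos v) (_ , sym eq)))
      where unique = proj₂ (proj₂ (pairCover x (other (c , u)) (λ e → other-apart c u (sym e))))

    other-injective : ∀ p q → other p ≡ other q → p ≡ q
    other-injective (c , u) (d , v) eq with refl ← blk-injective u v (same-block c u d v eq) =
      cong (_, u) (punchIn-injective (pos u) c d (same-position (cong group eq)))

    f : Fin (3 * groupSize m) ⊎ Fin (groupSize h) → Fin (sum type)
    f (inj₁ p) = other (remQuot (groupSize m) p)
    f (inj₂ v) = member h v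

    f-injective : ∀ p q → f p ≡ f q → p ≡ q
    f-injective (inj₁ p) (inj₁ q) eq =
      cong inj₁ (remQuot-injective {3} (other-injective _ _ eq))
    f-injective (inj₁ p) (inj₂ v) eq =
      contradiction (trans (cong group eq) (group-member h v)) (other-apart _ _)
    f-injective (inj₂ u) (inj₁ q) eq =
      contradiction (trans (cong group (sym eq)) (group-member h u)) (other-apart _ _)
    f-injective (inj₂ u) (inj₂ v) eq = cong inj₂ (member-injective h eq)

  -- A group of positive size has a point at which the count can start.
  groups-bound : ∀ {j m} → j ≢ m → 1 ≤ groupSize j → 3 * groupSize m + groupSize j ≤ sum type
  groups-bound {j} {m} j≢m 1≤j =
    subst (λ g → 3 * groupSize m + groupSize g ≤ sum type) x∈j
      (group-bound (member j (fromℕ< 1≤j)) m (λ e → j≢m (trans (sym x∈j) e)))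
    where x∈j = group-member j (fromℕ< 1≤j)

necessity : ∀ a b → 1 ≤ a → GDD4 (typeThm a b) → a ≤ b × b ≤ 2 * a
-- Pulling the permutation back along `groupSize` lists the groups themselves in the order of the
-- type. The list inherits distinctness from `allFin`, so its entries are different groups even
-- where two sizes coincide.
necessity a b 1≤a D with ↭-map-inv (GDD4.groupSize D) (GDD4.groupType D)
... | g ∷ _ ∷ _ ∷ _ ∷ m ∷ n ∷ [] , sizes , perm = ℕ.*-cancelˡ-≤ 3 left , ℕ.*-cancelˡ-≤ 6 right
  where
  open GDD4 D

  unique : Unique (g ∷ _ ∷ _ ∷ _ ∷ m ∷ n ∷ [])
  unique = Unique-resp-↭ (setoid _) (↭⇒↭ₛ perm) (Unique.allFin⁺ numGroups)

  g≢m : g ≢ m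
  g≢m with ((_ ∷ _ ∷ _ ∷ g≢m ∷ _) ∷ _) ← unique = g≢m

  m≢n : m ≢ n
  m≢n with (_ ∷ _ ∷ _ ∷ _ ∷ (m≢n ∷ _) ∷ _) ← unique = m≢n

  size-g : 3 * a ≡ groupSize g
  size-g = ∷-injectiveˡ sizes

  tail⁴ : 6 * a ∷ 3 * b ∷ [] ≡ groupSize m ∷ groupSize n ∷ []
  tail⁴ = ∷-injectiveʳ (∷-injectiveʳ (∷-injectiveʳ (∷-injectiveʳ sizes)))

  size-m : 6 * a ≡ groupSize m
  size-m = ∷-injectiveˡ tail⁴

  size-n : 3 * b ≡ groupSize n
  size-n = ∷-injectiveˡ (∷-injectiveʳ tail⁴)

  open ≤-Reasoning

  positive : ∀ k {s} → suc k * a ≡ s → 1 ≤ s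
  positive k refl = ℕ.≤-trans 1≤a (ℕ.m≤m+n a (k * a))

  left : 3 * a ≤ 3 * b
  -- The bound reads 21a ≤ 18a + 3b.
  left = ℕ.+-cancelˡ-≤ (18 * a) _ _ (begin
    18 * a + 3 * a                       ≡⟨ rearrange a ⟩
    3 * (6 * a) + 3 * a                  ≡⟨ cong₂ (λ s t → 3 * s + t) size-m size-g ⟩
    3 * groupSize m + groupSize g        ≤⟨ groups-bound D g≢m (positive 2 size-g) ⟩
    sum (typeThm a b)                    ≡⟨ total a b ⟩
    18 * a + 3 * b                       ∎)
    where
    rearrange : ∀ a → 18 * a + 3 * a ≡ 3 * (6 * a) + 3 * a
    rearrange = solve-∀
    total : ∀ a b → 3 * a + (3 * a + (3 * a + (3 * a + (6 * a + (3 * b + 0))))) ≡ 18 * a + 3 * b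
    total = solve-∀

  right : 6 * b ≤ 6 * (2 * a)
  -- The bound reads 9b + 6a ≤ 18a + 3b; removing 6a + 3b leaves 6b ≤ 12a.
  right = ℕ.+-cancelˡ-≤ (6 * a + 3 * b) _ _ (begin
    (6 * a + 3 * b) + 6 * b              ≡⟨ rearrange a b ⟩
    3 * (3 * b) + 6 * a                  ≡⟨ cong₂ (λ s t → 3 * s + t) size-n size-m ⟩
    3 * groupSize n + groupSize m        ≤⟨ groups-bound D m≢n (positive 5 size-m) ⟩
    sum (typeThm a b)                    ≡⟨ total a b ⟩
    (6 * a + 3 * b) + 6 * (2 * a)        ∎)
    where
    rearrange : ∀ a b → (6 * a + 3 * b) + 6 * b ≡ 3 * (3 * b) + 6 * a
    rearrange = solve-∀
    total : ∀ a b → 3 * a + (3 * a + (3 * a + (3 * a + (6 * a + (3 * b + 0))))) ≡ (6 * a + 3 * b) + 6 * (2 * a)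
    total = solve-∀

-- Finite disjoint unions and their numbering.

total : ∀ {n} → (Fin n → ℕ) → ℕ
total {zero}  f = 0
total {suc n} f = f zero + total (f ∘ suc)

total-const : ∀ n c → total {n} (λ _ → c) ≡ n * c
total-const zero    c = refl
total-const (suc n) c = cong (c +_) (total-const n c)

total-* : ∀ {n} c (f : Fin n → ℕ) → total (λ i → c * f i) ≡ c * total f
total-* {zero}  c f = sym (ℕ.*-zeroʳ c)
total-* {suc n} c f =
  trans (cong (c * f zero +_) (total-* c (f ∘ suc))) (sym (ℕ.*-distribˡ-+ c _ _))

total-+ : ∀ {n} c (f : Fin n → ℕ) → total (λ i → c + f i) ≡ n * c + total f
total-+ {zero}  c f = refl
total-+ {suc n} c f = trans (cong (c + f zero +_) (total-+ c (f ∘ suc))) (rearrange c (f zero) (n * c) _)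
  where
  rearrange : ∀ w x y z → w + x + (y + z) ≡ w + y + (x + z)
  rearrange = solve-∀

-- Fibre after fibre, this numbers the points of a design, the blocks of a composite design and the
-- orbits of a group action.
Σ-Fin↔ : ∀ {n} (f : Fin n → ℕ) → Σ (Fin n) (Fin ∘ f) ↔ Fin (total f)
Σ-Fin↔ {zero}  f = mk↔ₛ′ (λ ()) (λ ()) (λ ()) (λ ())
Σ-Fin↔ {suc n} f = mk↔ₛ′ fwd bwd fwd-bwd bwd-fwd
  where
  rest = Σ-Fin↔ (f ∘ suc)

  fwd : Σ (Fin (suc n)) (Fin ∘ f) → Fin (total f)
  fwd (zero  , x) = x ↑ˡ total (f ∘ suc)
  fwd (suc i , x) = f zero ↑ʳ to rest (i , x)

  unsplit : Fin (f zero) ⊎ Fin (total (f ∘ suc)) → Σ (Fin (suc n)) (Fin ∘ f)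
  unsplit (inj₁ x) = zero , x
  unsplit (inj₂ y) = let (i , x) = from rest y in suc i , x

  bwd : Fin (total f) → Σ (Fin (suc n)) (Fin ∘ f)
  bwd = unsplit ∘ splitAt (f zero)

  fwd-unsplit : ∀ s → fwd (unsplit s) ≡ join (f zero) _ s
  fwd-unsplit (inj₁ x) = refl
  fwd-unsplit (inj₂ y) = cong (f zero ↑ʳ_) (strictlyInverseˡ rest y)

  fwd-bwd : ∀ y → fwd (bwd y) ≡ y
  fwd-bwd y = trans (fwd-unsplit (splitAt (f zero) y)) (join-splitAt (f zero) _ y)

  bwd-fwd : ∀ p → bwd (fwd p) ≡ p
  bwd-fwd (zero  , x) = cong unsplit (splitAt-↑ˡ (f zero) x _)
  bwd-fwd (suc i , x) = trans (cong unsplit (splitAt-↑ʳ (f zero) _ (to rest (i , x))))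
    (cong (λ (j , y) → suc j , y) (strictlyInverseʳ rest (i , x)))

-- `GDD4` measures a group by filtering the list of all points, whereas a group built here is a
-- fibre of known size. Injections in both directions compare the two numbers.
fibre-size : ∀ {n} (f : Fin n → ℕ) j →
  length (filter (λ x → proj₁ (from (Σ-Fin↔ f) x) ≟ j) (allFin (total f))) ≡ f j
fibre-size {n} f j = ℕ.≤-antisym (injective⇒≤ {f = down} down-injective) (injective⇒≤ {f = up} up-injective)
  where
  e = Σ-Fin↔ f
  inFibre? = λ x → proj₁ (from e x) ≟ j
  fibre = filter inFibre? (allFin (total f))

  coordinate : (p : Σ (Fin n) (Fin ∘ f)) → proj₁ p ≡ j → Fin (f j)
  coordinate (_ , x) refl = x

  coordinate-injective : ∀ p q (p∈ : proj₁ p ≡ j) (q∈ : proj₁ q ≡ j) →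
    coordinate p p∈ ≡ coordinate q q∈ → p ≡ q
  coordinate-injective _ _ refl refl refl = refl

  lookup∈ : ∀ u → proj₁ (from e (lookup fibre u)) ≡ j
  lookup∈ u = proj₂ (∈-filter⁻ inFibre? {xs = allFin (total f)} (∈-lookup {xs = fibre} u))

  down : Fin (length fibre) → Fin (f j)
  down u = coordinate (from e (lookup fibre u)) (lookup∈ u)

  down-injective : Injective _≡_ _≡_ down
  down-injective {u} {v} eq = lookup-injective (Unique.filter⁺ inFibre? (Unique.allFin⁺ (total f)))
    (trans (sym (strictlyInverseˡ e _)) (trans
      (cong (to e) (coordinate-injective _ _ (lookup∈ u) (lookup∈ v) eq)) (strictlyInverseˡ e _)))

  to∈ : ∀ x → proj₁ (from e (to e (j , x))) ≡ j
  to∈ x = cong proj₁ (strictlyInverseʳ e (j , x))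

  up : Fin (f j) → Fin (length fibre)
  up x = index (∈-filter⁺ inFibre? (∈-allFin (to e (j , x))) (to∈ x))

  lookup-up : ∀ x → to e (j , x) ≡ lookup fibre (up x)
  lookup-up x = lookup-index (∈-filter⁺ inFibre? (∈-allFin (to e (j , x))) (to∈ x))

  up-injective : Injective _≡_ _≡_ up
  up-injective {x} {y} eq with refl ← trans (sym (strictlyInverseʳ e (j , x))) (trans
    (cong (from e) (trans (lookup-up x) (trans (cong (lookup fibre) eq) (sym (lookup-up y)))))
    (strictlyInverseʳ e (j , y))) = refl

-- Designs on six labelled groups.

-- The points of group k form an arbitrary type `X k` and the blocks an arbitrary finite type, so
-- that disjoint unions and products serve directly as points and blocks. `toGDD4` returns to
-- numbered points.
record Design (X : Fin 6 → Set) : Set₁ where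
  field
    Block : Set
    count : ℕ
    enum  : Block ↔ Fin count
    block : Block → Fin 4 → Σ (Fin 6) X
    transversal : ∀ B k l → k ≢ l → proj₁ (block B k) ≢ proj₁ (block B l)

  _∈B_ : Σ (Fin 6) X → Block → Set
  p ∈B B = ∃ λ k → block B k ≡ p

  field
    cover : ∀ p q → proj₁ p ≢ proj₁ q →
      Σ Block λ B → (p ∈B B × q ∈B B) × (∀ C → p ∈B C → q ∈B C → C ≡ B)

relabel : ∀ {X Y} → (∀ k → X k ↔ Y k) → Design X → Design Y
relabel {X} {Y} e D = record
  { Block = Block
  ; count = count
  ; enum  = enum
  ; block = λ B k → forth (block B k)
  ; transversal = transversal
  ; cover = λ p q p≢q →
      let (B , ((k , eqp) , (l , eqq)) , unique) = cover (back p) (back q) p≢q in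
      B , ((k , trans (cong forth eqp) (forth-back p)) , (l , trans (cong forth eqq) (forth-back q))) ,
      λ C (k′ , eqp′) (l′ , eqq′) → unique C (k′ , pull eqp′) (l′ , pull eqq′)
  }
  where
  open Design D
  forth : Σ (Fin 6) X → Σ (Fin 6) Y
  forth (k , x) = k , to (e k) x
  back : Σ (Fin 6) Y → Σ (Fin 6) X
  back (k , y) = k , from (e k) y
  forth-back : ∀ p → forth (back p) ≡ p
  forth-back (k , y) = cong (k ,_) (strictlyInverseˡ (e k) y)
  pull : ∀ {p q} → forth p ≡ q → p ≡ back q
  pull {k , x} refl = cong (k ,_) (sym (strictlyInverseʳ (e k) x))

size : ℕ → ℕ → Fin 6 → ℕ
size a b 0F = 3 * a
size a b 1F = 3 * a
size a b 2F = 3 * a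
size a b 3F = 3 * a
size a b 4F = 6 * a
size a b 5F = 3 * b

toGDD4 : ∀ {a b} → 1 ≤ a → Design (Fin ∘ size a b) → GDD4 (typeThm a b)
toGDD4 {a} {b} 1≤a D = record
  { numGroups = 6
  ; group     = proj₁ ∘ from e
  ; numBlocks = count
  ; block     = λ i k → to e (block (from enum i) k)
  ; groupType = ↭-reflexive (map-cong (fibre-size (size a b)) (allFin 6))
  -- Since a ≥ 1 the first two groups have points, and the block joining one point of each is a
  -- block.
  ; nonEmpty  = nonempty (to enum (proj₁ (cover (0F , pt₀) (1F , pt₀) λ ())))
  ; blockTransversal = λ i k l k≢l eq → transversal (from enum i) k l k≢l
      (trans (sym (cong proj₁ (strictlyInverseʳ e (block (from enum i) k))))
        (trans eq (cong proj₁ (strictlyInverseʳ e (block (from enum i) l)))))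
  ; pairCover = λ x y x≢y →
      let (B , ((k , eqx) , (l , eqy)) , unique) = cover (from e x) (from e y) x≢y in
      to enum B , ((k , push B eqx) , (l , push B eqy)) , λ i (k′ , eqx′) (l′ , eqy′) →
        trans (sym (strictlyInverseˡ enum i))
          (cong (to enum) (unique (from enum i) (k′ , pull eqx′) (l′ , pull eqy′)))
  }
  where
  open Design D
  e = Σ-Fin↔ (size a b)
  pt₀ : Fin (3 * a)
  pt₀ = fromℕ< (ℕ.≤-trans 1≤a (ℕ.m≤m+n a (2 * a)))
  nonempty : ∀ {n} → Fin n → 1 ≤ n
  nonempty {suc n} _ = s≤s z≤n
  push : ∀ B {k x} → block B k ≡ from e x → to e (block (from enum (to enum B)) k) ≡ x
  push B {k} {x} eq = trans (cong (λ C → to e (block C k)) (strictlyInverseʳ enum B))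
    (trans (cong (to e) eq) (strictlyInverseˡ e x))
  pull : ∀ {p x} → to e p ≡ x → p ≡ from e x
  pull {p} refl = sym (strictlyInverseʳ e p)

-- Transversal designs and Wilson's fundamental construction.

-- TD(6, t) as an orthogonal array: the block (x, y) meets group k in the point `coord k x y`. By
-- `meet` two points of different groups have a common block, by `separate` only one.
record TD6 (t : ℕ) : Set where
  field
    coord    : Fin 6 → Fin t → Fin t → Fin t
    meet     : ∀ {k l} → k ≢ l → ∀ u v → ∃₂ λ x y → coord k x y ≡ u × coord l x y ≡ v
    separate : ∀ {k l} → k ≢ l → ∀ {x y x′ y′} →
      coord k x y ≡ coord k x′ y′ → coord l x y ≡ coord l x′ y′ → x ≡ x′ × y ≡ y′

module _ {t} (T : TD6 t) (Y : Fin 6 → Fin t → Set)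
         (D : ∀ x y → Design (λ k → Y k (TD6.coord T k x y))) where
  open TD6 T

  private
    lift : ∀ x y → Σ (Fin 6) (λ k → Y k (coord k x y)) → Σ (Fin 6) (λ k → Σ (Fin t) (Y k))
    lift x y (k , z) = k , coord k x y , z

    lift-injective : ∀ {x y} p q → lift x y p ≡ lift x y q → p ≡ q
    lift-injective _ _ refl = refl

    lift-coord : ∀ {x y p k i z} → lift x y p ≡ (k , i , z) → coord k x y ≡ i
    lift-coord refl = refl

    finite : ∀ {B : Fin t → Set} {c : Fin t → ℕ} → (∀ i → B i ↔ Fin (c i)) → Σ (Fin t) B ↔ Fin (total c)
    finite {c = c} e = Σ-Fin↔ c ↔-∘ Σ-↔ (↔-id _) (e _)

  -- Point i of group k is inflated to the set `Y k i`, and every block to a design on the sets over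
  -- its points. Two points of different groups lie over two points of the transversal design, which
  -- determine (x, y); inside `D x y` they then determine the block.
  wilson : Design (λ k → Σ (Fin t) (Y k))
  wilson = record
    { Block = Σ (Fin t) λ x → Σ (Fin t) λ y → Design.Block (D x y)
    ; count = _
    ; enum  = finite λ x → finite λ y → Design.enum (D x y)
    ; block = λ (x , y , B) k → lift x y (Design.block (D x y) B k)
    ; transversal = λ (x , y , B) → Design.transversal (D x y) B
    ; cover = cover
    }
    where
    cover : ∀ p q → proj₁ p ≢ proj₁ q → _
    cover (k , i , u) (l , j , v) k≢l with meet k≢l i j
    ... | x , y , refl , refl with Design.cover (D x y) (k , u) (l , v) k≢l
    ...   | B , ((c , eqc) , (d , eqd)) , unique =
      (x , y , B) , ((c , cong (lift x y) eqc) , (d , cong (lift x y) eqd)) , unique′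
      where
      unique′ : ∀ C → _ → _ → C ≡ (x , y , B)
      unique′ (x′ , y′ , B′) (c′ , eqc′) (d′ , eqd′)
        with separate k≢l (lift-coord eqc′) (lift-coord eqd′)
      ... | refl , refl = cong (λ C → x , y , C)
        (unique B′ (c′ , lift-injective _ _ eqc′) (d′ , lift-injective _ _ eqd′))

-- All b belonging to one `a` are taken together because inflating a transversal design uses
-- ingredients with several values of b at once.
Spectrum : ℕ → Set₁
Spectrum a = ∀ b → a ≤ b → b ≤ 2 * a → Design (Fin ∘ size a b)

-- Greedy choice: each entry takes `a ⊓ e`, as much as it may hold, and hands `e ∸ a` on to the
-- others.
split : ∀ t a e → e ≤ t * a → ∃ λ (δ : Fin t → ℕ) → (∀ j → δ j ≤ a) × total δ ≡ e
split zero    a zero    _  = (λ ()) , (λ ()) , refl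
split (suc t) a e       e≤ with split t a (e ∸ a) (ℕ.m≤n+o⇒m∸n≤o e a e≤)
... | δ , δ≤ , eq = δ′ , δ′≤ , trans (cong (a ⊓ e +_) eq) (ℕ.m⊓n+n∸m≡n a e)
  where
  δ′ : Fin (suc t) → ℕ
  δ′ zero    = a ⊓ e
  δ′ (suc j) = δ j
  δ′≤ : ∀ j → δ′ j ≤ a
  δ′≤ zero    = ℕ.m⊓n≤m a e
  δ′≤ (suc j) = δ≤ j

spectrum-* : ∀ {t a} → TD6 t → Spectrum a → Spectrum (t * a)
-- What has to be distributed over the t points of the sixth group is the excess of b over t a. It
-- is at most t a, and each point takes at most a.
spectrum-* {t} {a} T S b ta≤b b≤2ta with split t a (b ∸ t * a) (ℕ.m≤n+o⇒m∸n≤o b (t * a) (subst (b ≤_) (double (t * a)) b≤2ta))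
  where
  double : ∀ n → 2 * n ≡ n + n
  double = solve-∀
... | δ , δ≤ , Σδ = relabel (λ k → ↔-reflexive (sizes k) ↔-∘ Σ-Fin↔ (λ j → size a (β j) k))
                      (wilson T (λ k j → Fin (size a (β j) k)) ingredient)
  where
  open TD6 T
  β : Fin t → ℕ
  β j = a + δ j

  ↔-reflexive : ∀ {m n} → m ≡ n → Fin m ↔ Fin n
  ↔-reflexive refl = ↔-id _

  ingredient : ∀ x y → Design (λ k → Fin (size a (β (coord k x y)) k))
  ingredient x y = relabel only-last (S (β j) (ℕ.m≤m+n a (δ j)) (ℕ.+-monoʳ-≤ a (ℕ.≤-trans (δ≤ j) (ℕ.m≤m+n a 0))))
    where
    j = coord 5F x y
    -- The size varies with `β` in the last group alone, where `coord k x y` is `j` by definition;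
    -- splitting on `k` lets both sides compute.
    only-last : ∀ k → Fin (size a (β j) k) ↔ Fin (size a (β (coord k x y)) k)
    only-last 0F = ↔-id _
    only-last 1F = ↔-id _
    only-last 2F = ↔-id _
    only-last 3F = ↔-id _
    only-last 4F = ↔-id _
    only-last 5F = ↔-id _

  swap-* : ∀ c → total {t} (λ _ → c * a) ≡ c * (t * a)
  swap-* c = trans (total-const t (c * a)) (swap t c a)
    where
    swap : ∀ t c a → t * (c * a) ≡ c * (t * a)
    swap = solve-∀

  sizes : ∀ k → total (λ j → size a (β j) k) ≡ size (t * a) b k
  sizes 0F = swap-* 3
  sizes 1F = swap-* 3
  sizes 2F = swap-* 3
  sizes 3F = swap-* 3
  sizes 4F = swap-* 6
  sizes 5F = trans (total-* 3 β) (cong (3 *_) (trans (total-+ a δ)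
    (trans (cong (t * a +_) Σδ) (ℕ.m+[n∸m]≡n ta≤b))))

-- Pigeonhole principles, and half the axioms of a transversal design from the other half.

-- If y were missed, punching it out of the codomain would inject a set of n + 1 elements into one
-- of n.
Fin-injective⇒surjective : ∀ {n} (f : Fin n → Fin n) → Injective _≡_ _≡_ f → ∀ y → ∃ λ x → f x ≡ y
Fin-injective⇒surjective {suc n} f f-inj y with any? (λ x → f x ≟ y)
... | yes found = found
... | no  ∄x    = contradiction (injective⇒≤ {f = λ x → punchOut (y≢ x)} λ {i} {j} eq →
                    f-inj (punchOut-injective (y≢ i) (y≢ j) eq)) ℕ.1+n≰n
  where
  y≢ : ∀ x → y ≢ f x
  y≢ x eq = ∄x (x , sym eq)

injective⇒surjective : ∀ {A : Set} {n} → A ↔ Fin n → (f : A → A) → (∀ {x y} → f x ≡ f y → x ≡ y) →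
  ∀ y → ∃ λ x → f x ≡ y
injective⇒surjective e f f-inj y =
  let (i , eq) = Fin-injective⇒surjective (to e ∘ f ∘ from e)
                   (λ eq → from-injective (f-inj (to-injective eq))) (to e y)
  in from e i , to-injective eq
  where
  to-injective   = Injection.injective (↔⇒↣ e)
  from-injective = Injection.injective (↔⇒↣ (↔-sym e))

surjective⇒injective : ∀ {A : Set} {n} → A ↔ Fin n → (f : A → A) → (∀ y → ∃ λ x → f x ≡ y) →
  ∀ {x y} → f x ≡ f y → x ≡ y
surjective⇒injective {A} e f f-surj {x} {y} eq
  with injective⇒surjective e g g-inj x | injective⇒surjective e g g-inj y
  where
  g : A → A
  g = proj₁ ∘ f-surj
  g-inj : ∀ {x y} → g x ≡ g y → x ≡ y
  g-inj {x} {y} eq = trans (sym (proj₂ (f-surj x))) (trans (cong f eq) (proj₂ (f-surj y)))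
... | u , refl | v , refl =
  cong (proj₁ ∘ f-surj) (trans (sym (proj₂ (f-surj u))) (trans eq (proj₂ (f-surj v))))

module _ {t} (coord : Fin 6 → Fin t → Fin t → Fin t) where

  private
    both : Fin 6 → Fin 6 → Fin t × Fin t → Fin t × Fin t
    both k l (x , y) = coord k x y , coord l x y

  -- Two coordinates together form a self-map of the finite set of pairs, so surjectivity gives
  -- injectivity. `separating⇒TD6` uses the reverse implication.
  meeting⇒TD6 : (∀ k l → k ≢ l → ∀ u v → ∃₂ λ x y → coord k x y ≡ u × coord l x y ≡ v) → TD6 t
  meeting⇒TD6 meet = record
    { coord = coord
    ; meet = λ k≢l → meet _ _ k≢l
    ; separate = λ {k} {l} k≢l eq eq′ →
        let pair≡ = surjective⇒injective (↔-sym *↔×) (both k l)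
                      (λ (u , v) → let (x , y , p , q) = meet k l k≢l u v in (x , y) , cong₂ _,_ p q)
                      (cong₂ _,_ eq eq′)
        in cong proj₁ pair≡ , cong proj₂ pair≡
    }

  separating⇒TD6 : (∀ k l → k ≢ l → ∀ {x y x′ y′} →
    coord k x y ≡ coord k x′ y′ → coord l x y ≡ coord l x′ y′ → x ≡ x′ × y ≡ y′) → TD6 t
  separating⇒TD6 separate = record
    { coord = coord
    ; meet = λ {k} {l} k≢l u v →
        let ((x , y) , eq) = injective⇒surjective (↔-sym *↔×) (both k l)
              (λ eq → let (p , q) = separate k l k≢l (cong proj₁ eq) (cong proj₂ eq) in cong₂ _,_ p q)
              (u , v)
        in x , y , cong proj₁ eq , cong proj₂ eq
    ; separate = λ k≢l → separate _ _ k≢l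
    }

-- Arithmetic modulo n, and the transversal designs of lines.

module Modular (n : ℕ) .{{_ : NonZero n}} where

  infix 4 _≈_
  _≈_ : ℕ → ℕ → Set
  x ≈ y = x % n ≡ y % n

  +-cong : ∀ {w x y z} → w ≈ x → y ≈ z → w + y ≈ x + z
  +-cong {w} {x} {y} {z} p q =
    trans (%-distribˡ-+ w y n) (trans (cong₂ (λ a b → (a + b) % n) p q) (sym (%-distribˡ-+ x z n)))

  -- A negative of x without truncated subtraction: x + x (n - 1) = x n.
  neg : ℕ → ℕ
  neg x = x * (n ∸ 1)

  +-neg : ∀ x y → y + (x + neg x) ≈ y
  +-neg x y = trans (cong (λ z → (y + z) % n) x+neg≡) ([m+kn]%n≡m%n y x n)
    where
    x+neg≡ : x + neg x ≡ x * n
    x+neg≡ = trans (sym (ℕ.*-suc x (n ∸ 1))) (cong (x *_) (ℕ.suc-pred n))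

  +-cancelʳ : ∀ {x y} z → x + z ≈ y + z → x ≈ y
  +-cancelʳ {x} {y} z eq = trans (sym (cancelled x)) (trans (+-cong eq refl) (cancelled y))
    where
    cancelled : ∀ w → w + z + neg z ≈ w
    cancelled w = trans (cong (_% n) (ℕ.+-assoc w z (neg z))) (+-neg z w)

  +-cancelˡ : ∀ {x y} z → z + x ≈ z + y → x ≈ y
  +-cancelˡ {x} {y} z eq rewrite ℕ.+-comm z x | ℕ.+-comm z y = +-cancelʳ z eq

  -- n divides j (y - x) and is prime to j, so it divides y - x; as y - x < n, this difference is 0.
  *-cancel-≤ : ∀ {j x y} → Coprime n j → x ≤ y → y < n → j * x ≈ j * y → x ≡ y
  *-cancel-≤ {j} {x} {y} cop x≤y y<n eq with y ∸ x in d≡ | coprime-divisor cop n∣jd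
    where
    n∣jd : n ∣ j * (y ∸ x)
    n∣jd = m%n≡0⇒n∣m _ n (trans (+-cancelˡ (j * x) (begin-equality
      (j * x + j * (y ∸ x)) % n  ≡⟨ cong (_% n) (ℕ.*-distribˡ-+ j x (y ∸ x)) ⟨
      (j * (x + (y ∸ x))) % n    ≡⟨ cong (λ z → (j * z) % n) (ℕ.m+[n∸m]≡n x≤y) ⟩
      (j * y) % n                ≡⟨ eq ⟨
      (j * x) % n                ≡⟨ cong (_% n) (ℕ.+-identityʳ (j * x)) ⟨
      (j * x + 0) % n            ∎)) (m*n%n≡0 0 n))
      where open ≤-Reasoning
  ... | zero  | _   = ℕ.≤-antisym x≤y (ℕ.m∸n≡0⇒m≤n d≡)
  ... | suc d | n∣d = contradiction n∣d (>⇒∤ (ℕ.≤-<-trans (subst (_≤ y) d≡ (ℕ.m∸n≤m y x)) y<n))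

  *-cancel-< : ∀ {j x y} → Coprime n j → x < n → y < n → j * x ≈ j * y → x ≡ y
  *-cancel-< {x = x} {y} cop x<n y<n eq with ℕ.≤-total x y
  ... | inj₁ x≤y = *-cancel-≤ cop x≤y y<n eq
  ... | inj₂ y≤x = sym (*-cancel-≤ cop y≤x x<n (sym eq))

  mod-toℕ : ∀ {x} (i : Fin n) → x ≈ toℕ i → x mod n ≡ i
  mod-toℕ {x} i eq = toℕ-injective (trans (toℕ-fromℕ< (m%n<n x n)) (trans eq (m<n⇒m%n≡m (toℕ<n i))))

  toℕ-mod : ∀ x → toℕ (x mod n) ≡ x % n
  toℕ-mod x = toℕ-fromℕ< (m%n<n x n)

  mod-injective : ∀ {x y} → x mod n ≡ y mod n → x ≈ y
  mod-injective {x} {y} eq = trans (sym (toℕ-mod x)) (trans (cong toℕ eq) (toℕ-mod y))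

-- Five parallel classes of lines y ↦ x + k y with slopes k = 0, …, 4, and the vertical class.
module _ (c : ℕ) .{{_ : NonZero c}} (2∤c : 2 ∤ c) (3∤c : 3 ∤ c) where
  open Modular c

  private
    -- The slopes 0, ..., 4 differ by 1 to 4, so a common divisor of c and a difference is at most
    -- 4. Being prime to 2 and 3 leaves only 1.
    small-coprime : ∀ j → 1 ≤ j → j ≤ 4 → Coprime c j
    small-coprime j 1≤j j≤4 {d} (d∣c , d∣j) = go d d∣c d∣j (ℕ.≤-trans (∣⇒≤ {{>-nonZero 1≤j}} d∣j) j≤4)
      where
      go : ∀ d → d ∣ c → d ∣ j → d ≤ 4 → d ≡ 1
      go 0 0∣c _ _ = contradiction (0∣⇒≡0 0∣c) (≢-nonZero⁻¹ c)
      go 1 _ _ _ = refl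
      go 2 2∣c _ _ = contradiction 2∣c 2∤c
      go 3 3∣c _ _ = contradiction 3∣c 3∤c
      go 4 4∣c _ _ = contradiction (∣-trans (divides-refl 2) 4∣c) 2∤c
      go (suc (suc (suc (suc (suc _))))) _ _ (s≤s (s≤s (s≤s (s≤s ()))))

    line : ℕ → Fin c → Fin c → ℕ
    line k x y = toℕ x + k * toℕ y

    coord : Fin 6 → Fin c → Fin c → Fin c
    coord 5F x y = y
    coord k  x y = line (toℕ k) x y mod c

    Separates : ℕ → ℕ → Set
    Separates k l = ∀ {x y x′ y′} → line k x y ≈ line k x′ y′ → line l x y ≈ line l x′ y′ → x ≡ x′ × y ≡ y′

    same-height : ∀ k {x y x′ y′} → line k x y ≈ line k x′ y′ → y ≡ y′ → x ≡ x′
    same-height k {x} {y} {x′} eq refl = toℕ-injective (begin-equality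
      toℕ x        ≡⟨ m<n⇒m%n≡m (toℕ<n x) ⟨
      toℕ x % c    ≡⟨ +-cancelʳ (k * toℕ y) eq ⟩
      toℕ x′ % c   ≡⟨ m<n⇒m%n≡m (toℕ<n x′) ⟩
      toℕ x′       ∎)
      where open ≤-Reasoning

    -- The difference of the two equations is j y ≡ j y′, and j is invertible modulo c. To avoid
    -- subtraction the equations are added crosswise and the common part x + x′ + k y + k y′ is
    -- cancelled.
    slopes-< : ∀ k j → 1 ≤ j → j ≤ 4 → Separates k (k + j)
    slopes-< k j 1≤j j≤4 {x} {y} {x′} {y′} eq eq′ = same-height k {x} {y} eq y≡y′ , y≡y′
      where
      crossed : ∀ x y x′ y′ k j →
        (x + x′ + k * y + k * y′) + j * y′ ≡ (x + k * y) + (x′ + (k + j) * y′)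
      crossed = solve-∀
      crossed′ : ∀ x y x′ y′ k j →
        (x + x′ + k * y + k * y′) + j * y ≡ (x′ + k * y′) + (x + (k + j) * y)
      crossed′ = solve-∀
      y≡y′ : y ≡ y′
      y≡y′ = toℕ-injective (*-cancel-< (small-coprime j 1≤j j≤4) (toℕ<n y) (toℕ<n y′)
        (+-cancelˡ (toℕ x + toℕ x′ + k * toℕ y + k * toℕ y′) (sym (begin-equality
          _ ≡⟨ cong (_% c) (crossed (toℕ x) (toℕ y) (toℕ x′) (toℕ y′) k j) ⟩
          _ ≡⟨ +-cong eq (sym eq′) ⟩
          _ ≡⟨ cong (_% c) (crossed′ (toℕ x) (toℕ y) (toℕ x′) (toℕ y′) k j) ⟨
          _ ∎))))
        where open ≤-Reasoning

    slopes : ∀ k l → k ≤ 4 → l ≤ 4 → k ≢ l → Separates k l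
    slopes k l k≤4 l≤4 k≢l {x} {y} eq eq′ with ℕ.<-cmp k l
    ... | tri≈ _ k≡l _ = contradiction k≡l k≢l
    ... | tri< k<l _ _ = slopes-< k (l ∸ k) (ℕ.m<n⇒0<n∸m k<l) (ℕ.≤-trans (ℕ.m∸n≤m l k) l≤4) {x} {y} eq
                           (subst (λ s → line s _ _ ≈ line s _ _) (sym (ℕ.m+[n∸m]≡n (ℕ.<⇒≤ k<l))) eq′)
    ... | tri> _ _ l<k = slopes-< l (k ∸ l) (ℕ.m<n⇒0<n∸m l<k) (ℕ.≤-trans (ℕ.m∸n≤m k l) k≤4) {x} {y} eq′
                           (subst (λ s → line s _ _ ≈ line s _ _) (sym (ℕ.m+[n∸m]≡n (ℕ.<⇒≤ l<k))) eq)

    -- `coord` computes only at a known index. Recording what equal coordinates mean in each class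
    -- of lines leaves four cases in `separates` instead of one for each pair of indices.
    data Position : Fin 6 → Set where
      slope    : ∀ {k} → toℕ k ≤ 4 → (∀ x y x′ y′ → coord k x y ≡ coord k x′ y′ →
                 line (toℕ k) x y ≈ line (toℕ k) x′ y′) → Position k
      vertical : Position 5F

    position : ∀ k → Position k
    position 0F = slope z≤n (λ _ _ _ _ → mod-injective)
    position 1F = slope (s≤s z≤n) (λ _ _ _ _ → mod-injective)
    position 2F = slope (s≤s (s≤s z≤n)) (λ _ _ _ _ → mod-injective)
    position 3F = slope (s≤s (s≤s (s≤s z≤n))) (λ _ _ _ _ → mod-injective)
    position 4F = slope (s≤s (s≤s (s≤s (s≤s z≤n)))) (λ _ _ _ _ → mod-injective)
    position 5F = vertical

    separates : ∀ k l → k ≢ l → ∀ {x y x′ y′} →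
      coord k x y ≡ coord k x′ y′ → coord l x y ≡ coord l x′ y′ → x ≡ x′ × y ≡ y′
    separates k l k≢l {x} {y} {x′} {y′} eq eq′ with position k | position l
    ... | slope k≤ on | slope l≤ on′ =
      slopes (toℕ k) (toℕ l) k≤ l≤ (k≢l ∘ toℕ-injective) {x} {y} (on x y x′ y′ eq) (on′ x y x′ y′ eq′)
    ... | slope _ on  | vertical      = same-height (toℕ k) {x} {y} (on x y x′ y′ eq) eq′ , eq′
    ... | vertical     | slope _ on   = same-height (toℕ l) {x} {y} (on x y x′ y′ eq′) eq , eq
    ... | vertical     | vertical      = contradiction refl k≢l

  cyclicTD6 : TD6 c
  cyclicTD6 = separating⇒TD6 coord separates

-- Transversal designs from difference matrices.

-- Addition and negation in ℤ/r₁ × ℤ/r₂ × ⋯, an element being coded by its digits in the mixed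
-- radix r₁, r₂, … (least significant first).
addDigits : List ℕ → ℕ → ℕ → ℕ
addDigits (r@(suc _) ∷ rs) x y = (x + y) % r + r * addDigits rs (x / r) (y / r)
addDigits _                x y = 0

negDigits : List ℕ → ℕ → ℕ
negDigits (r@(suc _) ∷ rs) x = (r ∸ x % r) % r + r * negDigits rs (x / r)
negDigits _                x = 0

module DifferenceMatrix (t : ℕ) .{{_ : NonZero t}} (radices : List ℕ) (rows : Vec (Vec ℕ t) 5) where

  -- The block (x, y) is column y of the matrix translated by the group element x; the sixth group
  -- records the column.
  code : Fin 6 → ℕ → Fin t → ℕ
  code 0F x y = addDigits radices x (Vec.lookup (Vec.lookup rows 0F) y)
  code 1F x y = addDigits radices x (Vec.lookup (Vec.lookup rows 1F) y)
  code 2F x y = addDigits radices x (Vec.lookup (Vec.lookup rows 2F) y)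
  code 3F x y = addDigits radices x (Vec.lookup (Vec.lookup rows 3F) y)
  code 4F x y = addDigits radices x (Vec.lookup (Vec.lookup rows 4F) y)
  code 5F x y = toℕ y

  coord : Fin 6 → Fin t → Fin t → Fin t
  coord k x y = code k (toℕ x) y mod t

  -- A block through the point u of group k. In column z the translation must be u minus the entry
  -- of row k; in the sixth group u is itself the column and z the translation. Searching for a
  -- block through two points thus has one free parameter.
  solution : Fin 6 → Fin t → Fin t → Fin t × Fin t
  solution 5F u z = z , u
  solution k  u z = (addDigits radices (toℕ u) (negDigits radices (code k 0 z)) mod t) , z

  Meets : Fin 6 → Fin 6 → Fin t → Fin t → Fin t → Set
  Meets k l u v z = let (x , y) = solution k u z in
    code k (toℕ x) y % t ≡ toℕ u × code l (toℕ x) y % t ≡ toℕ v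

  meeting? : Dec (∀ k l → k ≢ l → ∀ u v → ∃ (Meets k l u v))
  meeting? = all? λ k → all? λ l → ¬? (k ≟ l) →-dec all? λ u → all? λ v → any? λ z →
    let (x , y) = solution k u z in
    (code k (toℕ x) y % t ℕ.≟ toℕ u) ×-dec (code l (toℕ x) y % t ℕ.≟ toℕ v)

  differenceTD6 : {True meeting?} → TD6 t
  differenceTD6 {ok} = meeting⇒TD6 coord λ k l k≢l u v →
    let (z , p , q) = toWitness ok k l k≢l u v in
    _ , _ , toℕ-injective (trans (toℕ-mod _) p) , toℕ-injective (trans (toℕ-mod _) q)
    where open Modular t

-- The rows are the multiples by 0, 1, α, α + 1, α² in 𝔽₂[α]/(α³ + α + 1).
TD6-8 : TD6 8
TD6-8 = DifferenceMatrix.differenceTD6 8 (2 ∷ 2 ∷ 2 ∷ [])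
  ( (0 ∷ 0 ∷ 0 ∷ 0 ∷ 0 ∷ 0 ∷ 0 ∷ 0 ∷ [])
  ∷ (0 ∷ 1 ∷ 2 ∷ 3 ∷ 4 ∷ 5 ∷ 6 ∷ 7 ∷ [])
  ∷ (0 ∷ 2 ∷ 4 ∷ 6 ∷ 3 ∷ 1 ∷ 7 ∷ 5 ∷ [])
  ∷ (0 ∷ 3 ∷ 6 ∷ 5 ∷ 7 ∷ 4 ∷ 1 ∷ 2 ∷ [])
  ∷ (0 ∷ 4 ∷ 3 ∷ 7 ∷ 6 ∷ 2 ∷ 5 ∷ 1 ∷ []) ∷ [])

-- The rows are the multiples by 0, 1, 2, i, 1 + i in 𝔽₃[i]/(i² + 1).
TD6-9 : TD6 9
TD6-9 = DifferenceMatrix.differenceTD6 9 (3 ∷ 3 ∷ [])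
  ( (0 ∷ 0 ∷ 0 ∷ 0 ∷ 0 ∷ 0 ∷ 0 ∷ 0 ∷ 0 ∷ [])
  ∷ (0 ∷ 1 ∷ 2 ∷ 3 ∷ 4 ∷ 5 ∷ 6 ∷ 7 ∷ 8 ∷ [])
  ∷ (0 ∷ 2 ∷ 1 ∷ 6 ∷ 8 ∷ 7 ∷ 3 ∷ 5 ∷ 4 ∷ [])
  ∷ (0 ∷ 3 ∷ 6 ∷ 2 ∷ 5 ∷ 8 ∷ 1 ∷ 4 ∷ 7 ∷ [])
  ∷ (0 ∷ 4 ∷ 8 ∷ 5 ∷ 6 ∷ 1 ∷ 7 ∷ 2 ∷ 3 ∷ []) ∷ [])

-- Found by computer, as three pairwise orthogonal orthomorphisms of ℤ/6 × ℤ/2.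
TD6-12 : TD6 12
TD6-12 = DifferenceMatrix.differenceTD6 12 (6 ∷ 2 ∷ [])
  ( (0 ∷ 0 ∷ 0 ∷ 0 ∷ 0 ∷ 0 ∷ 0 ∷ 0 ∷ 0 ∷ 0 ∷ 0 ∷ 0 ∷ [])
  ∷ (0 ∷ 1 ∷ 2 ∷ 3 ∷ 4 ∷ 5 ∷ 6 ∷ 7 ∷ 8 ∷ 9 ∷ 10 ∷ 11 ∷ [])
  ∷ (0 ∷ 7 ∷ 11 ∷ 5 ∷ 2 ∷ 6 ∷ 4 ∷ 10 ∷ 9 ∷ 8 ∷ 3 ∷ 1 ∷ [])
  ∷ (0 ∷ 8 ∷ 5 ∷ 7 ∷ 6 ∷ 3 ∷ 11 ∷ 9 ∷ 2 ∷ 10 ∷ 1 ∷ 4 ∷ [])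
  ∷ (0 ∷ 3 ∷ 9 ∷ 8 ∷ 5 ∷ 11 ∷ 10 ∷ 6 ∷ 4 ∷ 1 ∷ 7 ∷ 2 ∷ []) ∷ [])

-- Designs developed from base blocks over ℤ/n.

coarsen : ∀ {a b x y} .{{_ : NonZero a}} .{{_ : NonZero b}} → a ∣ b → x % b ≡ y % b → x % a ≡ y % a
coarsen {a} {b} {x} {y} a∣b eq =
  trans (sym (m∣n⇒o%n%m≡o%m a b x a∣b)) (trans (cong (_% a) eq) (m∣n⇒o%n%m≡o%m a b y a∣b))

module _ {A : Set} where

  -- Unique existence is checked by counting solutions; a count of 1 yields a solution here and its
  -- uniqueness in `singleton-≡`.
  singleton-∈ : ∀ {xs : List A} → length xs ≡ 1 → ∃ (_∈ xs)
  singleton-∈ {x ∷ []} refl = x , here refl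

  singleton-≡ : ∀ {xs : List A} {x y} → length xs ≡ 1 → x ∈ xs → y ∈ xs → x ≡ y
  singleton-≡ {_ ∷ []} refl (here refl) (here refl) = refl

-- ℤ/n acts on the points. The list `orbits k` holds the lengths of the orbits that make up group
-- k; an orbit of length d (a divisor of n) is a copy of ℤ/d. All orbits being numbered
-- consecutively, n c + v (v < n) stands in a base block for the point v of the orbit number c.
module DifferenceFamily
  (n : ℕ) .{{_ : NonZero n}} (orbits : Fin 6 → List ℕ) .{{_ : NonZero (total (length ∘ orbits))}}
  {b : ℕ} (baseBlocks : Vec (Vec ℕ 4) b) where

  private
    module ℤ/n = Modular n

    m : Fin 6 → ℕ
    m = length ∘ orbits

    w : ∀ k → Fin (m k) → ℕ
    w k = lookup (orbits k)

    Orbit : Set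
    Orbit = Σ (Fin 6) (Fin ∘ m)

    Occurrence : Set
    Occurrence = Fin b × Fin 4

    entry : Occurrence → ℕ
    entry (i , e) = Vec.lookup (Vec.lookup baseBlocks i) e

    -- The reduction modulo `total m` supplies an index for every number. Under `InRange` it changes
    -- nothing on the base blocks, so there the orbit determines the code.
    orbit : ℕ → Orbit
    orbit p = from (Σ-Fin↔ m) ((p / n) mod total m)

    code : ℕ → ℕ
    code p = p / n

    orbitCode : Orbit → ℕ
    orbitCode κ = toℕ (to (Σ-Fin↔ m) κ)

    toℕ-mod-total : ∀ p → toℕ (code p mod total m) ≡ code p % total m
    toℕ-mod-total p = toℕ-fromℕ< (m%n<n (code p) (total m))

    code⇒orbit : ∀ {p κ} → code p ≡ orbitCode κ → orbit p ≡ κ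
    code⇒orbit {p} {κ} eq = trans (cong (from (Σ-Fin↔ m)) (toℕ-injective (begin-equality
        toℕ (code p mod total m)    ≡⟨ toℕ-mod-total p ⟩
        code p % total m            ≡⟨ cong (_% total m) eq ⟩
        orbitCode κ % total m       ≡⟨ m<n⇒m%n≡m (toℕ<n (to (Σ-Fin↔ m) κ)) ⟩
        orbitCode κ                 ∎)))
      (strictlyInverseʳ (Σ-Fin↔ m) κ)
      where open ≤-Reasoning

    orbit⇒code : ∀ {p κ} → code p < total m → orbit p ≡ κ → code p ≡ orbitCode κ
    orbit⇒code {p} p< refl = trans (sym (m<n⇒m%n≡m p<)) (trans (sym (toℕ-mod-total p))
      (cong toℕ (sym (strictlyInverseˡ (Σ-Fin↔ m) _))))

    occurrences : ℕ → List Occurrence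
    occurrences c = filter (λ t → code (entry t) ℕ.≟ c) (cartesianProduct (allFin b) (allFin 4))

    -- An element ((i, e), f) stands for the ordered pair of positions e, f in base block i.
    companions : List Occurrence → ℕ → List (Occurrence × Fin 4)
    companions ts c = filter (λ ((i , _) , f) → code (entry (i , f)) ℕ.≟ c) (cartesianProduct ts (allFin 4))

    InRange : Set
    InRange = ∀ i e → code (entry (i , e)) < total m

    inRange? : Dec InRange
    inRange? = all? λ i → all? λ e → code (entry (i , e)) ℕ.<? total m

    -- `neg` negates modulo n, hence modulo every divisor of n.
    difference : Occurrence × Fin 4 → ℕ
    difference ((i , e) , f) = entry (i , f) + ℤ/n.neg (entry (i , e))

    with-difference : ∀ d → .{{_ : NonZero d}} → List (Occurrence × Fin 4) → Fin d → List (Occurrence × Fin 4)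
    with-difference d ts δ = filter (λ t → difference t % d ℕ.≟ toℕ δ) ts

    Once : ∀ d → .{{_ : NonZero d}} → List (Occurrence × Fin 4) → Set
    Once d ts = ∀ δ → length (with-difference d ts δ) ≡ 1

    once? : ∀ d → .{{_ : NonZero d}} → ∀ ts → Dec (Once d ts)
    once? d ts = all? λ δ → length (with-difference d ts δ) ℕ.≟ 1

    Divides : Set
    Divides = ∀ k o → w k o ∣ n

    divides? : Dec Divides
    divides? = all? λ k → all? λ o → w k o ∣? n

    Transversal : Set
    Transversal = ∀ i e f → e ≢ f → proj₁ (orbit (entry (i , e))) ≢ proj₁ (orbit (entry (i , f)))

    transversal? : Dec Transversal
    transversal? = all? λ i → all? λ e → all? λ f →
      ¬? (e ≟ f) →-dec ¬? (proj₁ (orbit (entry (i , e))) ≟ proj₁ (orbit (entry (i , f))))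

    -- A point in an orbit of length n determines the translation carrying a given entry to it. With
    -- such an orbit in every pair, counting differences decides both existence and uniqueness of
    -- the joining block.
    Regular : Set
    Regular = ∀ k o k′ o′ → k ≢ k′ → w k o ≡ n ⊎ w k′ o′ ≡ n

    regular? : Dec Regular
    regular? = all? λ k → all? λ o → all? λ k′ → all? λ o′ →
      ¬? (k ≟ k′) →-dec ((w k o ℕ.≟ n) ⊎-dec (w k′ o′ ℕ.≟ n))

    module _ (w∣n : Divides) where

      instance
        w≢0 : ∀ {k o} → NonZero (w k o)
        w≢0 {k} {o} = ≢-nonZero λ w≡0 → ≢-nonZero⁻¹ n (0∣⇒≡0 (subst (_∣ n) w≡0 (w∣n k o)))

      AllOnce : Fin 6 → List Occurrence → Set
      AllOnce k ts = ∀ k′ o′ → k ≢ k′ → Once (w k′ o′) (companions ts (orbitCode (k′ , o′)))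

      allOnce? : ∀ k ts → Dec (AllOnce k ts)
      allOnce? k ts = all? λ k′ → all? λ o′ → ¬? (k ≟ k′) →-dec once? (w k′ o′) (companions ts (orbitCode (k′ , o′)))

      -- The difference family condition: between an orbit of length n and an orbit in another
      -- group, each difference modulo the length of the second comes from exactly one pair of
      -- positions.
      Exact : Set
      Exact = ∀ k o → w k o ≡ n → AllOnce k (occurrences (orbitCode (k , o)))

      exact? : Dec Exact
      exact? = all? λ k → all? λ o → (w k o ℕ.≟ n) →-dec allOnce? k (occurrences (orbitCode (k , o)))

      Point : Fin 6 → Set
      Point k = Σ (Fin (m k)) (Fin ∘ w k)

      place : Orbit → ℕ → Σ (Fin 6) Point
      place (k , o) v = k , o , v mod w k o

      place-≡ : ∀ {κ k o x v} → κ ≡ (k , o) → v % w k o ≡ toℕ x % w k o → place κ v ≡ (k , o , x)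
      place-≡ {k = k} {o} {x} refl eq = cong (λ y → k , o , y) (Modular.mod-toℕ (w k o) x eq)

      place-orbit : ∀ {κ k o x v} → place κ v ≡ (k , o , x) → κ ≡ (k , o)
      place-orbit refl = refl

      place-value : ∀ {κ k o x v} → place κ v ≡ (k , o , x) → v % w k o ≡ toℕ x % w k o
      place-value {k , o} {v = v} refl =
        sym (trans (cong (_% w k o) (Modular.toℕ-mod (w k o) v)) (m%n%n≡m%n v (w k o)))

      -- The part n c of an entry n c + v vanishes modulo the orbit length, a divisor of n, so the
      -- entry can be shifted without being decoded.
      translate : Fin n → ℕ → Σ (Fin 6) Point
      translate s p = place (orbit p) (p + toℕ s)

      module _ (inRange : InRange) (exact : Exact) where

        _∈B_ : Σ (Fin 6) Point → Fin b × Fin n → Set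
        q ∈B (i , s) = ∃ λ e → translate s (entry (i , e)) ≡ q

        Cover : Σ (Fin 6) Point → Σ (Fin 6) Point → Set
        Cover p q = Σ (Fin b × Fin n) λ B → (p ∈B B × q ∈B B) × (∀ C → p ∈B C → q ∈B C → C ≡ B)

        module _ {k o k′ o′} (k≢k′ : k ≢ k′) (w≡n : w k o ≡ n) (x : Fin (w k o)) (y : Fin (w k′ o′)) where

          module ℤ/w′ = Modular (w k′ o′)
          open ℤ/n using (neg; _≈_)

          -- The difference y - x. Translation preserves it, so it must already occur in the base
          -- block.
          δ : Fin (w k′ o′)
          δ = (toℕ y + neg (toℕ x)) mod w k′ o′

          pairs : List (Occurrence × Fin 4)
          pairs = companions (occurrences (orbitCode (k , o))) (orbitCode (k′ , o′))

          joins? = λ (t : Occurrence × Fin 4) → difference t % w k′ o′ ℕ.≟ toℕ δ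

          once : length (filter joins? pairs) ≡ 1
          once = exact k o w≡n k′ o′ k≢k′ δ

          joint : ∃ (_∈ filter joins? pairs)
          joint = singleton-∈ once

          i = proj₁ (proj₁ (proj₁ joint))
          e = proj₂ (proj₁ (proj₁ joint))
          f = proj₂ (proj₁ joint)
          found = ∈-filter⁻ joins? {xs = pairs} (proj₂ joint)
          pᵉ = entry (i , e)
          pᶠ = entry (i , f)

          companion = ∈-filter⁻ _ {xs = cartesianProduct (occurrences (orbitCode (k , o))) (allFin 4)} (proj₁ found)
          occurrence = ∈-filter⁻ _ {xs = cartesianProduct (allFin b) (allFin 4)}
            (proj₁ (∈-cartesianProduct⁻ (occurrences (orbitCode (k , o))) (allFin 4) (proj₁ companion)))

          orbitᵉ : orbit pᵉ ≡ (k , o)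
          orbitᵉ = code⇒orbit (proj₂ occurrence)

          orbitᶠ : orbit pᶠ ≡ (k′ , o′)
          orbitᶠ = code⇒orbit (proj₂ companion)

          n∣w : n ∣ w k o
          n∣w = ∣-reflexive (sym w≡n)

          toℕ-δ : toℕ δ ≡ (toℕ y + neg (toℕ x)) % w k′ o′
          toℕ-δ = ℤ/w′.toℕ-mod _

          -- The translation x - `pᵉ`, carrying the entry `pᵉ` to x.
          s : Fin n
          s = (toℕ x + neg pᵉ) mod n

          s≈ : ∀ z → z + toℕ s ≈ z + (toℕ x + neg pᵉ)
          s≈ z = ℤ/n.+-cong {z} refl (trans (cong (_% n) (ℤ/n.toℕ-mod _)) (m%n%n≡m%n _ n))

          cancel-neg : ∀ z t → t + (z + neg z) ℤ/w′.≈ t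
          cancel-neg z t = coarsen (w∣n k′ o′) (ℤ/n.+-neg z t)

          valueᵉ : pᵉ + toℕ s ≈ toℕ x
          valueᵉ = trans (s≈ pᵉ) (trans (cong (_% n) (rearrange pᵉ (toℕ x) (neg pᵉ))) (ℤ/n.+-neg pᵉ (toℕ x)))
            where
            rearrange : ∀ p x q → p + (x + q) ≡ x + (p + q)
            rearrange = solve-∀

          valueᶠ : pᶠ + toℕ s ℤ/w′.≈ toℕ y
          valueᶠ = begin-equality
            (pᶠ + toℕ s) % w k′ o′                   ≡⟨ coarsen (w∣n k′ o′) (s≈ pᶠ) ⟩
            (pᶠ + (toℕ x + neg pᵉ)) % w k′ o′        ≡⟨ cong (_% w k′ o′) (rearrange pᶠ (toℕ x) (neg pᵉ)) ⟩
            (pᶠ + neg pᵉ + toℕ x) % w k′ o′          ≡⟨ ℤ/w′.+-cong {pᶠ + neg pᵉ} (trans (proj₂ found) toℕ-δ) refl ⟩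
            (toℕ y + neg (toℕ x) + toℕ x) % w k′ o′  ≡⟨ cong (_% w k′ o′) (rearrange′ (toℕ y) (neg (toℕ x)) (toℕ x)) ⟩
            (toℕ y + (toℕ x + neg (toℕ x))) % w k′ o′ ≡⟨ cancel-neg (toℕ x) (toℕ y) ⟩
            toℕ y % w k′ o′                          ∎
            where
            open ≤-Reasoning
            rearrange : ∀ p x q → p + (x + q) ≡ p + q + x
            rearrange = solve-∀
            rearrange′ : ∀ y z x → y + z + x ≡ y + (x + z)
            rearrange′ = solve-∀

          -- A block (j, s′) through both points exhibits the same difference y - x, so by `once` it
          -- uses the same base block and positions. Then `pᵉ` + s′ and `pᵉ` + s are both x modulo
          -- n, which forces s′ = s.
          unique : ∀ C → (k , o , x) ∈B C → (k′ , o′ , y) ∈B C → C ≡ (i , s)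
          unique (j , s′) (g , eqᵍ) (h , eqʰ) with singleton-≡ once (proj₂ joint) (∈-filter⁺ joins?
              (∈-filter⁺ _ (∈-cartesianProduct⁺ (∈-filter⁺ _ (∈-cartesianProduct⁺ (∈-allFin j) (∈-allFin g))
                (orbit⇒code (inRange j g) (place-orbit eqᵍ))) (∈-allFin h)) (orbit⇒code (inRange j h) (place-orbit eqʰ))) same-difference)
            where
            pᵍ = entry (j , g)
            pʰ = entry (j , h)
            open ≤-Reasoning
            valueᵍ : pᵍ + toℕ s′ ≈ toℕ x
            valueᵍ = coarsen n∣w (place-value eqᵍ)
            rearrange : ∀ p q s r → p + q + (s + r) ≡ p + s + (r + q)
            rearrange = solve-∀
            rearrange′ : ∀ y q s r → y + q + (s + r) ≡ r + s + (y + q)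
            rearrange′ = solve-∀
            rearrange″ : ∀ x y q → x + (y + q) ≡ y + (x + q)
            rearrange″ = solve-∀
            same-difference : difference ((j , g) , h) % w k′ o′ ≡ toℕ δ
            -- Adding s′ + `pᵍ` to both sides turns the left into `pʰ` + s′, which is y. As `pᵍ` +
            -- s′ is x, the right becomes (y - x) + x.
            same-difference = trans (ℤ/w′.+-cancelʳ (toℕ s′ + pᵍ) (begin-equality
              (pʰ + neg pᵍ + (toℕ s′ + pᵍ)) % w k′ o′            ≡⟨ cong (_% w k′ o′) (rearrange pʰ (neg pᵍ) (toℕ s′) pᵍ) ⟩
              (pʰ + toℕ s′ + (pᵍ + neg pᵍ)) % w k′ o′            ≡⟨ cancel-neg pᵍ (pʰ + toℕ s′) ⟩
              (pʰ + toℕ s′) % w k′ o′                            ≡⟨ place-value eqʰ ⟩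
              toℕ y % w k′ o′                                    ≡⟨ cancel-neg (toℕ x) (toℕ y) ⟨
              (toℕ y + (toℕ x + neg (toℕ x))) % w k′ o′          ≡⟨ cong (_% w k′ o′) (rearrange″ (toℕ x) (toℕ y) (neg (toℕ x))) ⟨
              (toℕ x + (toℕ y + neg (toℕ x))) % w k′ o′          ≡⟨ ℤ/w′.+-cong {pᵍ + toℕ s′} (coarsen (w∣n k′ o′) valueᵍ) refl ⟨
              (pᵍ + toℕ s′ + (toℕ y + neg (toℕ x))) % w k′ o′    ≡⟨ cong (_% w k′ o′) (rearrange′ (toℕ y) (neg (toℕ x)) (toℕ s′) pᵍ) ⟨
              (toℕ y + neg (toℕ x) + (toℕ s′ + pᵍ)) % w k′ o′    ∎)) (sym toℕ-δ)
          ... | refl = cong (i ,_) (toℕ-injective (begin-equality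
              toℕ s′       ≡⟨ m<n⇒m%n≡m (toℕ<n s′) ⟨
              toℕ s′ % n   ≡⟨ ℤ/n.+-cancelˡ pᵉ (trans (coarsen n∣w (place-value eqᵍ)) (sym valueᵉ)) ⟩
              toℕ s % n    ≡⟨ m<n⇒m%n≡m (toℕ<n s) ⟩
              toℕ s        ∎))
            where open ≤-Reasoning

          cover-regular : Cover (k , o , x) (k′ , o′ , y)
          cover-regular = (i , s) , ((e , place-≡ orbitᵉ (coarsen (w∣n k o) valueᵉ)) , (f , place-≡ orbitᶠ valueᶠ)) , unique

        cover : Regular → ∀ p q → proj₁ p ≢ proj₁ q → Cover p q
        cover regular (k , o , x) (k′ , o′ , y) k≢k′ with regular k o k′ o′ k≢k′
        ... | inj₁ w≡n  = cover-regular k≢k′ w≡n x y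
        ... | inj₂ w′≡n = let (B , (∈B , ∈B′) , unique) = cover-regular (k≢k′ ∘ sym) w′≡n y x in
          B , (∈B′ , ∈B) , λ C ∈C ∈C′ → unique C ∈C′ ∈C

      difference-design : InRange → Transversal → Regular → Exact → Design Point
      difference-design inRange transversal regular exact = record
        { Block = Fin b × Fin n
        ; count = b * n
        ; enum  = ↔-sym *↔×
        ; block = λ (i , s) e → translate s (entry (i , e))
        ; transversal = λ (i , s) → transversal i
        ; cover = cover inRange exact regular
        }

  -- The conditions on the base blocks are decidable and enter as implicit arguments, so writing
  -- down a design below makes the type checker verify it by evaluation.
  developed : {dividing : True divides?} {_ : True inRange?} {_ : True transversal?} {_ : True regular?}
    {_ : True (exact? (toWitness dividing))} {g : Fin 6 → ℕ} {_ : True (all? λ k → total (w k) ℕ.≟ g k)} →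
    Design (Fin ∘ g)
  developed {dividing} {inRange} {transversal} {regular} {exact} {g} {sizes} =
    relabel (λ k → subst (λ s → _ ↔ Fin s) (toWitness sizes k) (Σ-Fin↔ (w k)))
      (difference-design (toWitness dividing) (toWitness inRange) (toWitness transversal)
        (toWitness regular) (toWitness exact))

-- Base blocks for a = 1, 2, 3, 4, 6.

[_,_,_,_] : ℕ → ℕ → ℕ → ℕ → Vec ℕ 4
[ p , q , r , s ] = p ∷ q ∷ r ∷ s ∷ []

-- For n = 1 each point is its own orbit, and the base blocks are all the blocks.
points : Fin 6 → List ℕ
points 4F = replicate 6 1
points _  = replicate 3 1

-- With n = 3a each of the first four groups is one full orbit and the fifth is two. Below, the last
-- group consists of 3b fixed points when b is even, and of one orbit of length 3 and fixed points
-- when b is odd. A fixed point meets each of the six full orbits once, hence lies in two base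
-- blocks.
regular : ℕ → List ℕ → Fin 6 → List ℕ
regular n lengths 4F = n ∷ n ∷ []
regular n lengths 5F = lengths
regular n lengths _  = n ∷ []

-- The five groups of size 3 form one parallel class of a Kirkman triple system. The six points of
-- the fifth group stand for the other classes, each being added to the five triples of its class.
design-1-1 : Design (Fin ∘ size 1 1)
design-1-1 = DifferenceFamily.developed 1 points
  ( [ 0 , 3 , 17 , 18 ] ∷ [ 0 , 4 , 7 , 16 ] ∷ [ 0 , 5 , 10 , 14 ] ∷ [ 0 , 6 , 9 , 15 ]
  ∷ [ 0 , 8 , 13 , 19 ] ∷ [ 0 , 11 , 12 , 20 ] ∷ [ 1 , 3 , 6 , 12 ] ∷ [ 1 , 4 , 11 , 14 ]
  ∷ [ 1 , 5 , 15 , 19 ] ∷ [ 1 , 7 , 13 , 20 ] ∷ [ 1 , 8 , 10 , 17 ] ∷ [ 1 , 9 , 16 , 18 ]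
  ∷ [ 2 , 3 , 9 , 13 ] ∷ [ 2 , 4 , 15 , 20 ] ∷ [ 2 , 5 , 8 , 16 ] ∷ [ 2 , 6 , 14 , 18 ]
  ∷ [ 2 , 7 , 11 , 17 ] ∷ [ 2 , 10 , 12 , 19 ] ∷ [ 3 , 7 , 10 , 15 ] ∷ [ 3 , 8 , 14 , 20 ]
  ∷ [ 3 , 11 , 16 , 19 ] ∷ [ 4 , 6 , 17 , 19 ] ∷ [ 4 , 8 , 9 , 12 ] ∷ [ 4 , 10 , 13 , 18 ]
  ∷ [ 5 , 6 , 11 , 13 ] ∷ [ 5 , 7 , 12 , 18 ] ∷ [ 5 , 9 , 17 , 20 ] ∷ [ 6 , 10 , 16 , 20 ]
  ∷ [ 7 , 9 , 14 , 19 ] ∷ [ 8 , 11 , 15 , 18 ] ∷ [])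

design-1-2 : Design (Fin ∘ size 1 2)
design-1-2 = DifferenceFamily.developed 3 (regular 3 (replicate 6 1))
  ( [ 0 , 4 , 6 , 10 ] ∷ [ 2 , 4 , 12 , 18 ] ∷ [ 7 , 10 , 15 , 18 ] ∷ [ 0 , 8 , 12 , 21 ]
  ∷ [ 4 , 11 , 15 , 21 ] ∷ [ 1 , 10 , 12 , 24 ] ∷ [ 5 , 8 , 15 , 24 ] ∷ [ 5 , 6 , 12 , 27 ]
  ∷ [ 1 , 9 , 15 , 27 ] ∷ [ 3 , 11 , 12 , 30 ] ∷ [ 2 , 6 , 15 , 30 ] ∷ [ 7 , 9 , 12 , 33 ]
  ∷ [ 0 , 3 , 15 , 33 ] ∷ [])

design-2-2 : Design (Fin ∘ size 2 2)
design-2-2 = DifferenceFamily.developed 6 (regular 6 (replicate 6 1))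
  ( [ 8 , 13 , 18 , 24 ] ∷ [ 0 , 14 , 20 , 24 ] ∷ [ 4 , 10 , 21 , 24 ] ∷ [ 5 , 9 , 16 , 24 ]
  ∷ [ 9 , 17 , 18 , 30 ] ∷ [ 4 , 16 , 19 , 30 ] ∷ [ 1 , 6 , 20 , 30 ] ∷ [ 0 , 7 , 13 , 30 ]
  ∷ [ 3 , 11 , 24 , 36 ] ∷ [ 14 , 22 , 30 , 36 ] ∷ [ 2 , 17 , 24 , 42 ] ∷ [ 10 , 23 , 30 , 42 ]
  ∷ [ 1 , 23 , 24 , 48 ] ∷ [ 8 , 12 , 30 , 48 ] ∷ [ 6 , 15 , 24 , 54 ] ∷ [ 3 , 21 , 30 , 54 ]
  ∷ [ 7 , 19 , 24 , 60 ] ∷ [ 5 , 15 , 30 , 60 ] ∷ [ 12 , 22 , 24 , 66 ] ∷ [ 2 , 11 , 30 , 66 ] ∷ [])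

design-2-3 : Design (Fin ∘ size 2 3)
design-2-3 = DifferenceFamily.developed 6 (regular 6 (3 ∷ replicate 6 1))
  ( [ 0 , 8 , 14 , 20 ] ∷ [ 8 , 15 , 18 , 24 ] ∷ [ 1 , 12 , 23 , 24 ] ∷ [ 1 , 7 , 20 , 30 ]
  ∷ [ 4 , 8 , 17 , 30 ] ∷ [ 5 , 10 , 24 , 36 ] ∷ [ 0 , 12 , 26 , 36 ] ∷ [ 6 , 20 , 25 , 36 ]
  ∷ [ 4 , 19 , 31 , 36 ] ∷ [ 11 , 13 , 30 , 36 ] ∷ [ 14 , 18 , 32 , 36 ] ∷ [ 0 , 9 , 24 , 42 ]
  ∷ [ 16 , 23 , 30 , 42 ] ∷ [ 3 , 13 , 24 , 48 ] ∷ [ 10 , 21 , 30 , 48 ] ∷ [ 2 , 20 , 24 , 54 ]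
  ∷ [ 9 , 14 , 30 , 54 ] ∷ [ 7 , 17 , 24 , 60 ] ∷ [ 2 , 19 , 30 , 60 ] ∷ [ 6 , 21 , 24 , 66 ]
  ∷ [ 0 , 15 , 30 , 66 ] ∷ [ 14 , 22 , 24 , 72 ] ∷ [ 5 , 6 , 30 , 72 ] ∷ [])

design-2-4 : Design (Fin ∘ size 2 4)
design-2-4 = DifferenceFamily.developed 6 (regular 6 (replicate 12 1))
  ( [ 0 , 6 , 14 , 20 ] ∷ [ 0 , 8 , 15 , 19 ] ∷ [ 1 , 11 , 24 , 36 ] ∷ [ 14 , 19 , 30 , 36 ]
  ∷ [ 2 , 9 , 24 , 42 ] ∷ [ 17 , 20 , 30 , 42 ] ∷ [ 4 , 14 , 24 , 48 ] ∷ [ 8 , 23 , 30 , 48 ]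
  ∷ [ 5 , 12 , 24 , 54 ] ∷ [ 9 , 22 , 30 , 54 ] ∷ [ 3 , 20 , 24 , 60 ] ∷ [ 11 , 15 , 30 , 60 ]
  ∷ [ 0 , 21 , 24 , 66 ] ∷ [ 10 , 13 , 30 , 66 ] ∷ [ 10 , 16 , 24 , 72 ] ∷ [ 0 , 18 , 30 , 72 ]
  ∷ [ 8 , 13 , 24 , 78 ] ∷ [ 5 , 21 , 30 , 78 ] ∷ [ 6 , 18 , 24 , 84 ] ∷ [ 4 , 16 , 30 , 84 ]
  ∷ [ 7 , 23 , 24 , 90 ] ∷ [ 1 , 12 , 30 , 90 ] ∷ [ 17 , 19 , 24 , 96 ] ∷ [ 2 , 7 , 30 , 96 ]
  ∷ [ 15 , 22 , 24 , 102 ] ∷ [ 3 , 6 , 30 , 102 ] ∷ [])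

design-3-3 : Design (Fin ∘ size 3 3)
design-3-3 = DifferenceFamily.developed 9 (regular 9 (3 ∷ replicate 6 1))
  ( [ 15 , 22 , 32 , 36 ] ∷ [ 12 , 18 , 35 , 36 ] ∷ [ 0 , 20 , 33 , 36 ] ∷ [ 7 , 24 , 30 , 36 ]
  ∷ [ 1 , 16 , 31 , 36 ] ∷ [ 4 , 14 , 19 , 36 ] ∷ [ 13 , 26 , 31 , 45 ] ∷ [ 1 , 20 , 29 , 45 ]
  ∷ [ 7 , 14 , 33 , 45 ] ∷ [ 2 , 15 , 27 , 45 ] ∷ [ 8 , 16 , 24 , 45 ] ∷ [ 4 , 9 , 18 , 45 ]
  ∷ [ 2 , 11 , 36 , 54 ] ∷ [ 0 , 18 , 37 , 54 ] ∷ [ 15 , 31 , 38 , 54 ] ∷ [ 7 , 27 , 47 , 54 ]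
  ∷ [ 13 , 23 , 46 , 54 ] ∷ [ 19 , 35 , 45 , 54 ] ∷ [ 6 , 9 , 36 , 63 ] ∷ [ 25 , 28 , 45 , 63 ]
  ∷ [ 3 , 25 , 36 , 72 ] ∷ [ 10 , 32 , 45 , 72 ] ∷ [ 5 , 27 , 36 , 81 ] ∷ [ 11 , 23 , 45 , 81 ]
  ∷ [ 10 , 21 , 36 , 90 ] ∷ [ 3 , 30 , 45 , 90 ] ∷ [ 17 , 28 , 36 , 99 ] ∷ [ 0 , 21 , 45 , 99 ]
  ∷ [ 23 , 34 , 36 , 108 ] ∷ [ 6 , 17 , 45 , 108 ] ∷ [])

design-3-4 : Design (Fin ∘ size 3 4)
design-3-4 = DifferenceFamily.developed 9 (regular 9 (replicate 12 1))
  ( [ 0 , 15 , 21 , 35 ] ∷ [ 11 , 19 , 34 , 36 ] ∷ [ 2 , 22 , 30 , 36 ] ∷ [ 0 , 17 , 33 , 36 ]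
  ∷ [ 5 , 10 , 23 , 36 ] ∷ [ 12 , 24 , 34 , 45 ] ∷ [ 2 , 19 , 32 , 45 ] ∷ [ 4 , 14 , 33 , 45 ]
  ∷ [ 6 , 9 , 25 , 45 ] ∷ [ 3 , 12 , 36 , 54 ] ∷ [ 18 , 27 , 45 , 54 ] ∷ [ 1 , 14 , 36 , 63 ]
  ∷ [ 26 , 28 , 45 , 63 ] ∷ [ 4 , 20 , 36 , 72 ] ∷ [ 13 , 30 , 45 , 72 ] ∷ [ 7 , 21 , 36 , 81 ]
  ∷ [ 10 , 31 , 45 , 81 ] ∷ [ 8 , 35 , 36 , 90 ] ∷ [ 15 , 20 , 45 , 90 ] ∷ [ 6 , 31 , 36 , 99 ]
  ∷ [ 11 , 21 , 45 , 99 ] ∷ [ 15 , 24 , 36 , 108 ] ∷ [ 3 , 35 , 45 , 108 ] ∷ [ 16 , 18 , 36 , 117 ]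
  ∷ [ 7 , 29 , 45 , 117 ] ∷ [ 9 , 27 , 36 , 126 ] ∷ [ 8 , 23 , 45 , 126 ] ∷ [ 13 , 28 , 36 , 135 ]
  ∷ [ 0 , 22 , 45 , 135 ] ∷ [ 25 , 32 , 36 , 144 ] ∷ [ 1 , 17 , 45 , 144 ] ∷ [ 26 , 29 , 36 , 153 ]
  ∷ [ 5 , 16 , 45 , 153 ] ∷ [])

design-3-5 : Design (Fin ∘ size 3 5)
design-3-5 = DifferenceFamily.developed 9 (regular 9 (3 ∷ replicate 12 1))
  ( [ 0 , 16 , 24 , 34 ] ∷ [ 0 , 10 , 20 , 32 ] ∷ [ 10 , 19 , 27 , 36 ] ∷ [ 7 , 21 , 35 , 36 ]
  ∷ [ 0 , 12 , 35 , 45 ] ∷ [ 3 , 16 , 22 , 45 ] ∷ [ 8 , 13 , 36 , 54 ] ∷ [ 3 , 19 , 37 , 54 ]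
  ∷ [ 9 , 33 , 38 , 54 ] ∷ [ 7 , 34 , 45 , 54 ] ∷ [ 14 , 21 , 46 , 54 ] ∷ [ 26 , 35 , 47 , 54 ]
  ∷ [ 5 , 11 , 36 , 63 ] ∷ [ 25 , 32 , 45 , 63 ] ∷ [ 6 , 17 , 36 , 72 ] ∷ [ 18 , 29 , 45 , 72 ]
  ∷ [ 0 , 22 , 36 , 81 ] ∷ [ 10 , 31 , 45 , 81 ] ∷ [ 3 , 24 , 36 , 90 ] ∷ [ 17 , 28 , 45 , 90 ]
  ∷ [ 4 , 28 , 36 , 99 ] ∷ [ 15 , 19 , 45 , 99 ] ∷ [ 1 , 30 , 36 , 108 ] ∷ [ 14 , 26 , 45 , 108 ]
  ∷ [ 15 , 20 , 36 , 117 ] ∷ [ 8 , 30 , 45 , 117 ] ∷ [ 12 , 23 , 36 , 126 ] ∷ [ 6 , 27 , 45 , 126 ]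
  ∷ [ 9 , 34 , 36 , 135 ] ∷ [ 5 , 23 , 45 , 135 ] ∷ [ 14 , 33 , 36 , 144 ] ∷ [ 4 , 21 , 45 , 144 ]
  ∷ [ 26 , 32 , 36 , 153 ] ∷ [ 2 , 11 , 45 , 153 ] ∷ [ 25 , 29 , 36 , 162 ] ∷ [ 1 , 9 , 45 , 162 ] ∷ [])

design-3-6 : Design (Fin ∘ size 3 6)
design-3-6 = DifferenceFamily.developed 9 (regular 9 (replicate 18 1))
  ( [ 0 , 14 , 22 , 33 ] ∷ [ 0 , 11 , 20 , 34 ] ∷ [ 0 , 10 , 23 , 27 ] ∷ [ 0 , 9 , 36 , 54 ]
  ∷ [ 25 , 34 , 45 , 54 ] ∷ [ 8 , 12 , 36 , 63 ] ∷ [ 21 , 27 , 45 , 63 ] ∷ [ 5 , 17 , 36 , 72 ]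
  ∷ [ 23 , 35 , 45 , 72 ] ∷ [ 4 , 21 , 36 , 81 ] ∷ [ 10 , 28 , 45 , 81 ] ∷ [ 3 , 24 , 36 , 90 ]
  ∷ [ 16 , 32 , 45 , 90 ] ∷ [ 7 , 26 , 36 , 99 ] ∷ [ 12 , 33 , 45 , 99 ] ∷ [ 6 , 29 , 36 , 108 ]
  ∷ [ 13 , 20 , 45 , 108 ] ∷ [ 2 , 33 , 36 , 117 ] ∷ [ 14 , 19 , 45 , 117 ] ∷ [ 1 , 30 , 36 , 126 ]
  ∷ [ 15 , 18 , 45 , 126 ] ∷ [ 13 , 19 , 36 , 135 ] ∷ [ 4 , 30 , 45 , 135 ] ∷ [ 14 , 25 , 36 , 144 ]
  ∷ [ 8 , 29 , 45 , 144 ] ∷ [ 10 , 20 , 36 , 153 ] ∷ [ 3 , 31 , 45 , 153 ] ∷ [ 11 , 35 , 36 , 162 ]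
  ∷ [ 6 , 24 , 45 , 162 ] ∷ [ 15 , 28 , 36 , 171 ] ∷ [ 1 , 26 , 45 , 171 ] ∷ [ 16 , 27 , 36 , 180 ]
  ∷ [ 7 , 22 , 45 , 180 ] ∷ [ 23 , 31 , 36 , 189 ] ∷ [ 0 , 17 , 45 , 189 ] ∷ [ 18 , 34 , 36 , 198 ]
  ∷ [ 2 , 9 , 45 , 198 ] ∷ [ 22 , 32 , 36 , 207 ] ∷ [ 5 , 11 , 45 , 207 ] ∷ [])

design-4-4 : Design (Fin ∘ size 4 4)
design-4-4 = DifferenceFamily.developed 12 (regular 12 (replicate 12 1))
  ( [ 17 , 26 , 36 , 48 ] ∷ [ 21 , 32 , 44 , 48 ] ∷ [ 6 , 25 , 40 , 48 ] ∷ [ 8 , 28 , 39 , 48 ]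
  ∷ [ 0 , 15 , 41 , 48 ] ∷ [ 9 , 20 , 42 , 48 ] ∷ [ 7 , 12 , 29 , 48 ] ∷ [ 4 , 18 , 31 , 48 ]
  ∷ [ 19 , 33 , 37 , 60 ] ∷ [ 14 , 32 , 41 , 60 ] ∷ [ 1 , 26 , 39 , 60 ] ∷ [ 11 , 29 , 43 , 60 ]
  ∷ [ 3 , 13 , 45 , 60 ] ∷ [ 8 , 12 , 36 , 60 ] ∷ [ 2 , 15 , 25 , 60 ] ∷ [ 4 , 16 , 28 , 60 ]
  ∷ [ 3 , 22 , 48 , 72 ] ∷ [ 27 , 44 , 60 , 72 ] ∷ [ 2 , 23 , 48 , 84 ] ∷ [ 34 , 40 , 60 , 84 ]
  ∷ [ 5 , 33 , 48 , 96 ] ∷ [ 22 , 38 , 60 , 96 ] ∷ [ 1 , 34 , 48 , 108 ] ∷ [ 21 , 46 , 60 , 108 ]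
  ∷ [ 10 , 45 , 48 , 120 ] ∷ [ 20 , 35 , 60 , 120 ] ∷ [ 11 , 38 , 48 , 132 ] ∷ [ 23 , 30 , 60 , 132 ]
  ∷ [ 16 , 24 , 48 , 144 ] ∷ [ 6 , 42 , 60 , 144 ] ∷ [ 19 , 35 , 48 , 156 ] ∷ [ 10 , 47 , 60 , 156 ]
  ∷ [ 14 , 43 , 48 , 168 ] ∷ [ 5 , 31 , 60 , 168 ] ∷ [ 13 , 46 , 48 , 180 ] ∷ [ 7 , 24 , 60 , 180 ]
  ∷ [ 30 , 37 , 48 , 192 ] ∷ [ 0 , 18 , 60 , 192 ] ∷ [ 27 , 47 , 48 , 204 ] ∷ [ 9 , 17 , 60 , 204 ] ∷ [])

design-4-5 : Design (Fin ∘ size 4 5)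
design-4-5 = DifferenceFamily.developed 12 (regular 12 (3 ∷ replicate 12 1))
  ( [ 0 , 12 , 24 , 44 ] ∷ [ 22 , 26 , 39 , 48 ] ∷ [ 23 , 32 , 38 , 48 ] ∷ [ 10 , 31 , 36 , 48 ]
  ∷ [ 8 , 33 , 44 , 48 ] ∷ [ 4 , 14 , 37 , 48 ] ∷ [ 1 , 21 , 24 , 48 ] ∷ [ 13 , 31 , 41 , 60 ]
  ∷ [ 9 , 35 , 39 , 60 ] ∷ [ 10 , 23 , 37 , 60 ] ∷ [ 3 , 20 , 44 , 60 ] ∷ [ 6 , 15 , 26 , 60 ]
  ∷ [ 2 , 16 , 29 , 60 ] ∷ [ 11 , 17 , 48 , 72 ] ∷ [ 1 , 31 , 49 , 72 ] ∷ [ 18 , 36 , 50 , 72 ]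
  ∷ [ 0 , 47 , 61 , 72 ] ∷ [ 19 , 27 , 60 , 72 ] ∷ [ 26 , 40 , 62 , 72 ] ∷ [ 2 , 13 , 48 , 84 ]
  ∷ [ 33 , 42 , 60 , 84 ] ∷ [ 3 , 19 , 48 , 96 ] ∷ [ 30 , 45 , 60 , 96 ] ∷ [ 5 , 27 , 48 , 108 ]
  ∷ [ 14 , 36 , 60 , 108 ] ∷ [ 9 , 28 , 48 , 120 ] ∷ [ 21 , 40 , 60 , 120 ] ∷ [ 7 , 47 , 48 , 132 ]
  ∷ [ 18 , 28 , 60 , 132 ] ∷ [ 6 , 43 , 48 , 144 ] ∷ [ 17 , 34 , 60 , 144 ] ∷ [ 18 , 25 , 48 , 156 ]
  ∷ [ 1 , 47 , 60 , 156 ] ∷ [ 20 , 34 , 48 , 168 ] ∷ [ 0 , 43 , 60 , 168 ] ∷ [ 12 , 45 , 48 , 180 ]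
  ∷ [ 8 , 25 , 60 , 180 ] ∷ [ 15 , 40 , 48 , 192 ] ∷ [ 4 , 32 , 60 , 192 ] ∷ [ 29 , 41 , 48 , 204 ]
  ∷ [ 5 , 12 , 60 , 204 ] ∷ [ 35 , 42 , 48 , 216 ] ∷ [ 7 , 22 , 60 , 216 ] ∷ [])

design-4-6 : Design (Fin ∘ size 4 6)
design-4-6 = DifferenceFamily.developed 12 (regular 12 (replicate 18 1))
  ( [ 0 , 16 , 26 , 39 ] ∷ [ 0 , 19 , 35 , 47 ] ∷ [ 19 , 34 , 38 , 48 ] ∷ [ 0 , 29 , 36 , 48 ]
  ∷ [ 5 , 15 , 42 , 48 ] ∷ [ 1 , 16 , 35 , 48 ] ∷ [ 21 , 35 , 43 , 60 ] ∷ [ 4 , 32 , 37 , 60 ]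
  ∷ [ 7 , 15 , 39 , 60 ] ∷ [ 2 , 20 , 33 , 60 ] ∷ [ 6 , 18 , 48 , 72 ] ∷ [ 24 , 46 , 60 , 72 ]
  ∷ [ 10 , 21 , 48 , 84 ] ∷ [ 29 , 38 , 60 , 84 ] ∷ [ 11 , 13 , 48 , 96 ] ∷ [ 34 , 40 , 60 , 96 ]
  ∷ [ 9 , 30 , 48 , 108 ] ∷ [ 16 , 36 , 60 , 108 ] ∷ [ 7 , 25 , 48 , 120 ] ∷ [ 23 , 41 , 60 , 120 ]
  ∷ [ 8 , 33 , 48 , 132 ] ∷ [ 22 , 47 , 60 , 132 ] ∷ [ 4 , 45 , 48 , 144 ] ∷ [ 17 , 26 , 60 , 144 ]
  ∷ [ 3 , 43 , 48 , 156 ] ∷ [ 19 , 27 , 60 , 156 ] ∷ [ 2 , 40 , 48 , 168 ] ∷ [ 13 , 31 , 60 , 168 ]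
  ∷ [ 12 , 24 , 48 , 180 ] ∷ [ 11 , 45 , 60 , 180 ] ∷ [ 17 , 28 , 48 , 192 ] ∷ [ 1 , 44 , 60 , 192 ]
  ∷ [ 14 , 31 , 48 , 204 ] ∷ [ 0 , 42 , 60 , 204 ] ∷ [ 23 , 44 , 48 , 216 ] ∷ [ 6 , 30 , 60 , 216 ]
  ∷ [ 22 , 39 , 48 , 228 ] ∷ [ 8 , 28 , 60 , 228 ] ∷ [ 20 , 46 , 48 , 240 ] ∷ [ 10 , 25 , 60 , 240 ]
  ∷ [ 26 , 37 , 48 , 252 ] ∷ [ 3 , 12 , 60 , 252 ] ∷ [ 32 , 47 , 48 , 264 ] ∷ [ 9 , 14 , 60 , 264 ]
  ∷ [ 27 , 41 , 48 , 276 ] ∷ [ 5 , 18 , 60 , 276 ] ∷ [])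

design-4-7 : Design (Fin ∘ size 4 7)
design-4-7 = DifferenceFamily.developed 12 (regular 12 (3 ∷ replicate 18 1))
  ( [ 0 , 13 , 28 , 43 ] ∷ [ 0 , 17 , 25 , 45 ] ∷ [ 0 , 21 , 34 , 41 ] ∷ [ 16 , 34 , 45 , 48 ]
  ∷ [ 0 , 32 , 44 , 48 ] ∷ [ 5 , 21 , 45 , 60 ] ∷ [ 7 , 18 , 30 , 60 ] ∷ [ 7 , 17 , 48 , 72 ]
  ∷ [ 3 , 24 , 49 , 72 ] ∷ [ 12 , 45 , 50 , 72 ] ∷ [ 11 , 41 , 61 , 72 ] ∷ [ 19 , 28 , 62 , 72 ]
  ∷ [ 32 , 37 , 60 , 72 ] ∷ [ 5 , 12 , 48 , 84 ] ∷ [ 31 , 41 , 60 , 84 ] ∷ [ 3 , 18 , 48 , 96 ]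
  ∷ [ 25 , 43 , 60 , 96 ] ∷ [ 6 , 20 , 48 , 108 ] ∷ [ 33 , 46 , 60 , 108 ] ∷ [ 9 , 33 , 48 , 120 ]
  ∷ [ 16 , 38 , 60 , 120 ] ∷ [ 11 , 30 , 48 , 132 ] ∷ [ 20 , 47 , 60 , 132 ] ∷ [ 8 , 25 , 48 , 144 ]
  ∷ [ 22 , 36 , 60 , 144 ] ∷ [ 4 , 38 , 48 , 156 ] ∷ [ 23 , 34 , 60 , 156 ] ∷ [ 1 , 39 , 48 , 168 ]
  ∷ [ 13 , 35 , 60 , 168 ] ∷ [ 10 , 47 , 48 , 180 ] ∷ [ 14 , 28 , 60 , 180 ] ∷ [ 21 , 28 , 48 , 192 ]
  ∷ [ 8 , 44 , 60 , 192 ] ∷ [ 19 , 24 , 48 , 204 ] ∷ [ 4 , 39 , 60 , 204 ] ∷ [ 13 , 29 , 48 , 216 ]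
  ∷ [ 3 , 42 , 60 , 216 ] ∷ [ 14 , 37 , 48 , 228 ] ∷ [ 6 , 24 , 60 , 228 ] ∷ [ 15 , 46 , 48 , 240 ]
  ∷ [ 2 , 29 , 60 , 240 ] ∷ [ 23 , 36 , 48 , 252 ] ∷ [ 1 , 27 , 60 , 252 ] ∷ [ 31 , 40 , 48 , 264 ]
  ∷ [ 0 , 12 , 60 , 264 ] ∷ [ 26 , 42 , 48 , 276 ] ∷ [ 11 , 19 , 60 , 276 ] ∷ [ 27 , 41 , 48 , 288 ]
  ∷ [ 9 , 15 , 60 , 288 ] ∷ [])

design-4-8 : Design (Fin ∘ size 4 8)
design-4-8 = DifferenceFamily.developed 12 (regular 12 (replicate 24 1))
  ( [ 0 , 18 , 34 , 43 ] ∷ [ 0 , 20 , 35 , 42 ] ∷ [ 0 , 12 , 29 , 47 ] ∷ [ 0 , 19 , 32 , 37 ]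
  ∷ [ 2 , 13 , 48 , 72 ] ∷ [ 26 , 38 , 60 , 72 ] ∷ [ 11 , 16 , 48 , 84 ] ∷ [ 25 , 47 , 60 , 84 ]
  ∷ [ 4 , 20 , 48 , 96 ] ∷ [ 29 , 45 , 60 , 96 ] ∷ [ 9 , 12 , 48 , 108 ] ∷ [ 33 , 36 , 60 , 108 ]
  ∷ [ 3 , 24 , 48 , 120 ] ∷ [ 22 , 46 , 60 , 120 ] ∷ [ 1 , 29 , 48 , 132 ] ∷ [ 19 , 40 , 60 , 132 ]
  ∷ [ 0 , 27 , 48 , 144 ] ∷ [ 17 , 37 , 60 , 144 ] ∷ [ 5 , 31 , 48 , 156 ] ∷ [ 15 , 42 , 60 , 156 ]
  ∷ [ 8 , 41 , 48 , 168 ] ∷ [ 18 , 30 , 60 , 168 ] ∷ [ 10 , 42 , 48 , 180 ] ∷ [ 14 , 24 , 60 , 180 ]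
  ∷ [ 7 , 46 , 48 , 192 ] ∷ [ 23 , 32 , 60 , 192 ] ∷ [ 6 , 44 , 48 , 204 ] ∷ [ 12 , 31 , 60 , 204 ]
  ∷ [ 15 , 26 , 48 , 216 ] ∷ [ 8 , 44 , 60 , 216 ] ∷ [ 22 , 30 , 48 , 228 ] ∷ [ 5 , 39 , 60 , 228 ]
  ∷ [ 14 , 32 , 48 , 240 ] ∷ [ 2 , 43 , 60 , 240 ] ∷ [ 19 , 33 , 48 , 252 ] ∷ [ 1 , 41 , 60 , 252 ]
  ∷ [ 21 , 40 , 48 , 264 ] ∷ [ 4 , 28 , 60 , 264 ] ∷ [ 18 , 47 , 48 , 276 ] ∷ [ 3 , 34 , 60 , 276 ]
  ∷ [ 17 , 45 , 48 , 288 ] ∷ [ 9 , 27 , 60 , 288 ] ∷ [ 23 , 37 , 48 , 300 ] ∷ [ 10 , 35 , 60 , 300 ]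
  ∷ [ 28 , 39 , 48 , 312 ] ∷ [ 11 , 21 , 60 , 312 ] ∷ [ 35 , 43 , 48 , 324 ] ∷ [ 7 , 16 , 60 , 324 ]
  ∷ [ 34 , 36 , 48 , 336 ] ∷ [ 6 , 20 , 60 , 336 ] ∷ [ 25 , 38 , 48 , 348 ] ∷ [ 0 , 13 , 60 , 348 ] ∷ [])

design-6-6 : Design (Fin ∘ size 6 6)
design-6-6 = DifferenceFamily.developed 18 (regular 18 (replicate 18 1))
  ( [ 18 , 52 , 68 , 72 ] ∷ [ 33 , 39 , 59 , 72 ] ∷ [ 26 , 51 , 55 , 72 ] ∷ [ 0 , 44 , 71 , 72 ]
  ∷ [ 8 , 43 , 60 , 72 ] ∷ [ 17 , 45 , 66 , 72 ] ∷ [ 4 , 20 , 54 , 72 ] ∷ [ 6 , 32 , 69 , 72 ]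
  ∷ [ 5 , 34 , 56 , 72 ] ∷ [ 14 , 24 , 37 , 72 ] ∷ [ 2 , 21 , 50 , 72 ] ∷ [ 11 , 28 , 48 , 72 ]
  ∷ [ 28 , 45 , 70 , 90 ] ∷ [ 33 , 48 , 71 , 90 ] ∷ [ 23 , 42 , 66 , 90 ] ∷ [ 16 , 49 , 59 , 90 ]
  ∷ [ 7 , 36 , 54 , 90 ] ∷ [ 9 , 43 , 69 , 90 ] ∷ [ 12 , 30 , 60 , 90 ] ∷ [ 5 , 26 , 67 , 90 ]
  ∷ [ 1 , 32 , 65 , 90 ] ∷ [ 4 , 27 , 53 , 90 ] ∷ [ 3 , 25 , 39 , 90 ] ∷ [ 15 , 35 , 47 , 90 ]
  ∷ [ 1 , 25 , 72 , 108 ] ∷ [ 50 , 61 , 90 , 108 ] ∷ [ 13 , 27 , 72 , 126 ] ∷ [ 51 , 63 , 90 , 126 ]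
  ∷ [ 10 , 22 , 72 , 144 ] ∷ [ 37 , 56 , 90 , 144 ] ∷ [ 15 , 42 , 72 , 162 ] ∷ [ 31 , 62 , 90 , 162 ]
  ∷ [ 16 , 38 , 72 , 180 ] ∷ [ 29 , 68 , 90 , 180 ] ∷ [ 3 , 41 , 72 , 198 ] ∷ [ 22 , 58 , 90 , 198 ]
  ∷ [ 12 , 70 , 72 , 216 ] ∷ [ 34 , 44 , 90 , 216 ] ∷ [ 9 , 63 , 72 , 234 ] ∷ [ 18 , 40 , 90 , 234 ]
  ∷ [ 7 , 62 , 72 , 252 ] ∷ [ 19 , 46 , 90 , 252 ] ∷ [ 35 , 53 , 72 , 270 ] ∷ [ 14 , 55 , 90 , 270 ]
  ∷ [ 23 , 46 , 72 , 288 ] ∷ [ 0 , 57 , 90 , 288 ] ∷ [ 19 , 40 , 72 , 306 ] ∷ [ 8 , 64 , 90 , 306 ]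
  ∷ [ 29 , 57 , 72 , 324 ] ∷ [ 10 , 52 , 90 , 324 ] ∷ [ 30 , 65 , 72 , 342 ] ∷ [ 2 , 41 , 90 , 342 ]
  ∷ [ 31 , 58 , 72 , 360 ] ∷ [ 13 , 38 , 90 , 360 ] ∷ [ 36 , 67 , 72 , 378 ] ∷ [ 6 , 21 , 90 , 378 ]
  ∷ [ 47 , 61 , 72 , 396 ] ∷ [ 17 , 24 , 90 , 396 ] ∷ [ 49 , 64 , 72 , 414 ] ∷ [ 11 , 20 , 90 , 414 ] ∷ [])

design-6-7 : Design (Fin ∘ size 6 7)
design-6-7 = DifferenceFamily.developed 18 (regular 18 (3 ∷ replicate 18 1))
  ( [ 0 , 23 , 50 , 54 ] ∷ [ 25 , 38 , 62 , 72 ] ∷ [ 21 , 37 , 60 , 72 ] ∷ [ 30 , 49 , 56 , 72 ]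
  ∷ [ 5 , 53 , 70 , 72 ] ∷ [ 9 , 45 , 61 , 72 ] ∷ [ 17 , 42 , 57 , 72 ] ∷ [ 1 , 28 , 69 , 72 ]
  ∷ [ 2 , 23 , 59 , 72 ] ∷ [ 0 , 31 , 51 , 72 ] ∷ [ 8 , 20 , 52 , 72 ] ∷ [ 35 , 53 , 55 , 90 ]
  ∷ [ 30 , 41 , 70 , 90 ] ∷ [ 8 , 50 , 63 , 90 ] ∷ [ 9 , 48 , 57 , 90 ] ∷ [ 16 , 24 , 54 , 90 ]
  ∷ [ 12 , 32 , 56 , 90 ] ∷ [ 3 , 18 , 64 , 90 ] ∷ [ 1 , 33 , 38 , 90 ] ∷ [ 10 , 21 , 51 , 90 ]
  ∷ [ 4 , 23 , 49 , 90 ] ∷ [ 16 , 32 , 72 , 108 ] ∷ [ 14 , 49 , 74 , 108 ] ∷ [ 19 , 69 , 73 , 108 ]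
  ∷ [ 9 , 68 , 92 , 108 ] ∷ [ 27 , 42 , 90 , 108 ] ∷ [ 53 , 61 , 91 , 108 ] ∷ [ 4 , 22 , 72 , 126 ]
  ∷ [ 39 , 71 , 90 , 126 ] ∷ [ 7 , 24 , 72 , 144 ] ∷ [ 37 , 67 , 90 , 144 ] ∷ [ 6 , 34 , 72 , 162 ]
  ∷ [ 44 , 65 , 90 , 162 ] ∷ [ 13 , 44 , 72 , 180 ] ∷ [ 26 , 59 , 90 , 180 ] ∷ [ 10 , 50 , 72 , 198 ]
  ∷ [ 31 , 58 , 90 , 198 ] ∷ [ 3 , 41 , 72 , 216 ] ∷ [ 25 , 68 , 90 , 216 ] ∷ [ 14 , 67 , 72 , 234 ]
  ∷ [ 19 , 36 , 90 , 234 ] ∷ [ 15 , 66 , 72 , 252 ] ∷ [ 22 , 47 , 90 , 252 ] ∷ [ 11 , 71 , 72 , 270 ]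
  ∷ [ 34 , 40 , 90 , 270 ] ∷ [ 33 , 43 , 72 , 288 ] ∷ [ 2 , 69 , 90 , 288 ] ∷ [ 35 , 39 , 72 , 306 ]
  ∷ [ 15 , 61 , 90 , 306 ] ∷ [ 27 , 48 , 72 , 324 ] ∷ [ 17 , 62 , 90 , 324 ] ∷ [ 19 , 54 , 72 , 342 ]
  ∷ [ 11 , 45 , 90 , 342 ] ∷ [ 29 , 63 , 72 , 360 ] ∷ [ 14 , 43 , 90 , 360 ] ∷ [ 26 , 55 , 72 , 378 ]
  ∷ [ 0 , 46 , 90 , 378 ] ∷ [ 40 , 58 , 72 , 396 ] ∷ [ 13 , 20 , 90 , 396 ] ∷ [ 36 , 64 , 72 , 414 ]
  ∷ [ 5 , 29 , 90 , 414 ] ∷ [ 46 , 65 , 72 , 432 ] ∷ [ 6 , 28 , 90 , 432 ] ∷ [])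

design-6-8 : Design (Fin ∘ size 6 8)
design-6-8 = DifferenceFamily.developed 18 (regular 18 (replicate 24 1))
  ( [ 0 , 24 , 50 , 58 ] ∷ [ 0 , 20 , 47 , 71 ] ∷ [ 34 , 38 , 55 , 72 ] ∷ [ 20 , 40 , 61 , 72 ]
  ∷ [ 10 , 36 , 69 , 72 ] ∷ [ 2 , 42 , 64 , 72 ] ∷ [ 3 , 19 , 59 , 72 ] ∷ [ 4 , 33 , 58 , 72 ]
  ∷ [ 6 , 32 , 44 , 72 ] ∷ [ 5 , 18 , 39 , 72 ] ∷ [ 24 , 41 , 66 , 90 ] ∷ [ 31 , 49 , 59 , 90 ]
  ∷ [ 3 , 40 , 70 , 90 ] ∷ [ 0 , 39 , 55 , 90 ] ∷ [ 14 , 23 , 71 , 90 ] ∷ [ 9 , 28 , 60 , 90 ]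
  ∷ [ 15 , 19 , 38 , 90 ] ∷ [ 6 , 29 , 52 , 90 ] ∷ [ 12 , 30 , 72 , 108 ] ∷ [ 43 , 61 , 90 , 108 ]
  ∷ [ 17 , 31 , 72 , 126 ] ∷ [ 36 , 68 , 90 , 126 ] ∷ [ 13 , 23 , 72 , 144 ] ∷ [ 44 , 57 , 90 , 144 ]
  ∷ [ 14 , 35 , 72 , 162 ] ∷ [ 42 , 69 , 90 , 162 ] ∷ [ 11 , 47 , 72 , 180 ] ∷ [ 26 , 62 , 90 , 180 ]
  ∷ [ 0 , 53 , 72 , 198 ] ∷ [ 32 , 63 , 90 , 198 ] ∷ [ 15 , 45 , 72 , 216 ] ∷ [ 25 , 54 , 90 , 216 ]
  ∷ [ 16 , 43 , 72 , 234 ] ∷ [ 30 , 67 , 90 , 234 ] ∷ [ 7 , 57 , 72 , 252 ] ∷ [ 21 , 53 , 90 , 252 ]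
  ∷ [ 1 , 65 , 72 , 270 ] ∷ [ 34 , 47 , 90 , 270 ] ∷ [ 9 , 70 , 72 , 288 ] ∷ [ 35 , 46 , 90 , 288 ]
  ∷ [ 8 , 68 , 72 , 306 ] ∷ [ 27 , 51 , 90 , 306 ] ∷ [ 21 , 37 , 72 , 324 ] ∷ [ 4 , 56 , 90 , 324 ]
  ∷ [ 26 , 41 , 72 , 342 ] ∷ [ 10 , 58 , 90 , 342 ] ∷ [ 24 , 52 , 72 , 360 ] ∷ [ 17 , 64 , 90 , 360 ]
  ∷ [ 25 , 50 , 72 , 378 ] ∷ [ 2 , 65 , 90 , 378 ] ∷ [ 28 , 63 , 72 , 396 ] ∷ [ 12 , 45 , 90 , 396 ]
  ∷ [ 29 , 56 , 72 , 414 ] ∷ [ 1 , 50 , 90 , 414 ] ∷ [ 27 , 71 , 72 , 432 ] ∷ [ 5 , 48 , 90 , 432 ]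
  ∷ [ 22 , 60 , 72 , 450 ] ∷ [ 13 , 37 , 90 , 450 ] ∷ [ 51 , 62 , 72 , 468 ] ∷ [ 16 , 33 , 90 , 468 ]
  ∷ [ 49 , 54 , 72 , 486 ] ∷ [ 7 , 22 , 90 , 486 ] ∷ [ 46 , 66 , 72 , 504 ] ∷ [ 8 , 20 , 90 , 504 ]
  ∷ [ 48 , 67 , 72 , 522 ] ∷ [ 11 , 18 , 90 , 522 ] ∷ [])

design-6-9 : Design (Fin ∘ size 6 9)
design-6-9 = DifferenceFamily.developed 18 (regular 18 (3 ∷ replicate 24 1))
  ( [ 0 , 29 , 53 , 59 ] ∷ [ 0 , 21 , 48 , 64 ] ∷ [ 0 , 33 , 37 , 56 ] ∷ [ 24 , 36 , 68 , 72 ]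
  ∷ [ 23 , 43 , 61 , 72 ] ∷ [ 12 , 39 , 70 , 72 ] ∷ [ 10 , 42 , 71 , 72 ] ∷ [ 3 , 35 , 69 , 72 ]
  ∷ [ 14 , 27 , 45 , 72 ] ∷ [ 22 , 36 , 62 , 90 ] ∷ [ 11 , 39 , 64 , 90 ] ∷ [ 1 , 24 , 66 , 90 ]
  ∷ [ 3 , 20 , 55 , 90 ] ∷ [ 14 , 34 , 50 , 90 ] ∷ [ 6 , 18 , 53 , 90 ] ∷ [ 1 , 29 , 72 , 108 ]
  ∷ [ 2 , 36 , 74 , 108 ] ∷ [ 34 , 63 , 73 , 108 ] ∷ [ 9 , 64 , 91 , 108 ] ∷ [ 21 , 50 , 92 , 108 ]
  ∷ [ 43 , 71 , 90 , 108 ] ∷ [ 9 , 18 , 72 , 126 ] ∷ [ 37 , 70 , 90 , 126 ] ∷ [ 8 , 34 , 72 , 144 ]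
  ∷ [ 49 , 61 , 90 , 144 ] ∷ [ 6 , 31 , 72 , 162 ] ∷ [ 46 , 69 , 90 , 162 ] ∷ [ 16 , 22 , 72 , 180 ]
  ∷ [ 45 , 65 , 90 , 180 ] ∷ [ 13 , 46 , 72 , 198 ] ∷ [ 23 , 59 , 90 , 198 ] ∷ [ 5 , 49 , 72 , 216 ]
  ∷ [ 25 , 57 , 90 , 216 ] ∷ [ 11 , 53 , 72 , 234 ] ∷ [ 30 , 58 , 90 , 234 ] ∷ [ 4 , 44 , 72 , 252 ]
  ∷ [ 31 , 68 , 90 , 252 ] ∷ [ 2 , 56 , 72 , 270 ] ∷ [ 29 , 44 , 90 , 270 ] ∷ [ 15 , 65 , 72 , 288 ]
  ∷ [ 21 , 52 , 90 , 288 ] ∷ [ 17 , 66 , 72 , 306 ] ∷ [ 35 , 42 , 90 , 306 ] ∷ [ 7 , 67 , 72 , 324 ]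
  ∷ [ 28 , 47 , 90 , 324 ] ∷ [ 20 , 48 , 72 , 342 ] ∷ [ 9 , 60 , 90 , 342 ] ∷ [ 21 , 47 , 72 , 360 ]
  ∷ [ 4 , 67 , 90 , 360 ] ∷ [ 32 , 37 , 72 , 378 ] ∷ [ 10 , 54 , 90 , 378 ] ∷ [ 19 , 40 , 72 , 396 ]
  ∷ [ 17 , 56 , 90 , 396 ] ∷ [ 30 , 63 , 72 , 414 ] ∷ [ 13 , 38 , 90 , 414 ] ∷ [ 26 , 57 , 72 , 432 ]
  ∷ [ 0 , 41 , 90 , 432 ] ∷ [ 28 , 55 , 72 , 450 ] ∷ [ 12 , 51 , 90 , 450 ] ∷ [ 25 , 64 , 72 , 468 ]
  ∷ [ 2 , 40 , 90 , 468 ] ∷ [ 41 , 58 , 72 , 486 ] ∷ [ 15 , 33 , 90 , 486 ] ∷ [ 51 , 60 , 72 , 504 ]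
  ∷ [ 16 , 32 , 90 , 504 ] ∷ [ 50 , 54 , 72 , 522 ] ∷ [ 5 , 27 , 90 , 522 ] ∷ [ 38 , 59 , 72 , 540 ]
  ∷ [ 7 , 26 , 90 , 540 ] ∷ [])

design-6-10 : Design (Fin ∘ size 6 10)
design-6-10 = DifferenceFamily.developed 18 (regular 18 (replicate 30 1))
  ( [ 0 , 30 , 48 , 66 ] ∷ [ 0 , 28 , 47 , 59 ] ∷ [ 0 , 35 , 44 , 55 ] ∷ [ 0 , 18 , 43 , 57 ]
  ∷ [ 20 , 50 , 66 , 72 ] ∷ [ 7 , 48 , 54 , 72 ] ∷ [ 17 , 24 , 69 , 72 ] ∷ [ 9 , 22 , 43 , 72 ]
  ∷ [ 30 , 36 , 62 , 90 ] ∷ [ 17 , 52 , 71 , 90 ] ∷ [ 7 , 26 , 69 , 90 ] ∷ [ 11 , 27 , 53 , 90 ]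
  ∷ [ 3 , 18 , 72 , 108 ] ∷ [ 37 , 54 , 90 , 108 ] ∷ [ 13 , 27 , 72 , 126 ] ∷ [ 43 , 68 , 90 , 126 ]
  ∷ [ 10 , 19 , 72 , 144 ] ∷ [ 44 , 67 , 90 , 144 ] ∷ [ 6 , 28 , 72 , 162 ] ∷ [ 48 , 70 , 90 , 162 ]
  ∷ [ 14 , 34 , 72 , 180 ] ∷ [ 45 , 66 , 90 , 180 ] ∷ [ 5 , 41 , 72 , 198 ] ∷ [ 20 , 55 , 90 , 198 ]
  ∷ [ 16 , 49 , 72 , 216 ] ∷ [ 24 , 58 , 90 , 216 ] ∷ [ 4 , 36 , 72 , 234 ] ∷ [ 35 , 65 , 90 , 234 ]
  ∷ [ 2 , 47 , 72 , 252 ] ∷ [ 32 , 56 , 90 , 252 ] ∷ [ 1 , 40 , 72 , 270 ] ∷ [ 19 , 59 , 90 , 270 ]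
  ∷ [ 15 , 68 , 72 , 288 ] ∷ [ 22 , 39 , 90 , 288 ] ∷ [ 11 , 62 , 72 , 306 ] ∷ [ 23 , 38 , 90 , 306 ]
  ∷ [ 8 , 71 , 72 , 324 ] ∷ [ 33 , 47 , 90 , 324 ] ∷ [ 12 , 55 , 72 , 342 ] ∷ [ 31 , 42 , 90 , 342 ]
  ∷ [ 0 , 56 , 72 , 360 ] ∷ [ 18 , 41 , 90 , 360 ] ∷ [ 29 , 45 , 72 , 378 ] ∷ [ 13 , 63 , 90 , 378 ]
  ∷ [ 21 , 52 , 72 , 396 ] ∷ [ 12 , 61 , 90 , 396 ] ∷ [ 25 , 53 , 72 , 414 ] ∷ [ 14 , 60 , 90 , 414 ]
  ∷ [ 33 , 37 , 72 , 432 ] ∷ [ 15 , 57 , 90 , 432 ] ∷ [ 31 , 51 , 72 , 450 ] ∷ [ 6 , 64 , 90 , 450 ]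
  ∷ [ 30 , 63 , 72 , 468 ] ∷ [ 1 , 50 , 90 , 468 ] ∷ [ 35 , 64 , 72 , 486 ] ∷ [ 5 , 51 , 90 , 486 ]
  ∷ [ 32 , 58 , 72 , 504 ] ∷ [ 9 , 49 , 90 , 504 ] ∷ [ 26 , 67 , 72 , 522 ] ∷ [ 8 , 46 , 90 , 522 ]
  ∷ [ 23 , 60 , 72 , 540 ] ∷ [ 3 , 40 , 90 , 540 ] ∷ [ 46 , 61 , 72 , 558 ] ∷ [ 0 , 29 , 90 , 558 ]
  ∷ [ 44 , 57 , 72 , 576 ] ∷ [ 2 , 28 , 90 , 576 ] ∷ [ 42 , 70 , 72 , 594 ] ∷ [ 10 , 34 , 90 , 594 ]
  ∷ [ 38 , 65 , 72 , 612 ] ∷ [ 16 , 21 , 90 , 612 ] ∷ [ 39 , 59 , 72 , 630 ] ∷ [ 4 , 25 , 90 , 630 ] ∷ [])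

design-6-11 : Design (Fin ∘ size 6 11)
design-6-11 = DifferenceFamily.developed 18 (regular 18 (3 ∷ replicate 30 1))
  ( [ 0 , 19 , 49 , 54 ] ∷ [ 0 , 28 , 45 , 56 ] ∷ [ 0 , 25 , 36 , 63 ] ∷ [ 0 , 24 , 47 , 64 ]
  ∷ [ 0 , 30 , 37 , 71 ] ∷ [ 24 , 40 , 61 , 72 ] ∷ [ 5 , 38 , 63 , 72 ] ∷ [ 9 , 26 , 68 , 90 ]
  ∷ [ 8 , 34 , 48 , 90 ] ∷ [ 4 , 26 , 72 , 108 ] ∷ [ 0 , 43 , 73 , 108 ] ∷ [ 24 , 68 , 74 , 108 ]
  ∷ [ 17 , 67 , 90 , 108 ] ∷ [ 28 , 36 , 91 , 108 ] ∷ [ 38 , 60 , 92 , 108 ] ∷ [ 12 , 30 , 72 , 126 ]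
  ∷ [ 38 , 70 , 90 , 126 ] ∷ [ 2 , 18 , 72 , 144 ] ∷ [ 52 , 65 , 90 , 144 ] ∷ [ 0 , 33 , 72 , 162 ]
  ∷ [ 46 , 56 , 90 , 162 ] ∷ [ 14 , 23 , 72 , 180 ] ∷ [ 43 , 69 , 90 , 180 ] ∷ [ 8 , 29 , 72 , 198 ]
  ∷ [ 40 , 59 , 90 , 198 ] ∷ [ 10 , 45 , 72 , 216 ] ∷ [ 21 , 54 , 90 , 216 ] ∷ [ 7 , 41 , 72 , 234 ]
  ∷ [ 29 , 60 , 90 , 234 ] ∷ [ 11 , 43 , 72 , 252 ] ∷ [ 31 , 61 , 90 , 252 ] ∷ [ 1 , 49 , 72 , 270 ]
  ∷ [ 30 , 55 , 90 , 270 ] ∷ [ 6 , 44 , 72 , 288 ] ∷ [ 23 , 62 , 90 , 288 ] ∷ [ 15 , 67 , 72 , 306 ]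
  ∷ [ 20 , 51 , 90 , 306 ] ∷ [ 16 , 65 , 72 , 324 ] ∷ [ 22 , 50 , 90 , 324 ] ∷ [ 9 , 57 , 72 , 342 ]
  ∷ [ 18 , 45 , 90 , 342 ] ∷ [ 13 , 55 , 72 , 360 ] ∷ [ 33 , 37 , 90 , 360 ] ∷ [ 3 , 60 , 72 , 378 ]
  ∷ [ 19 , 39 , 90 , 378 ] ∷ [ 35 , 53 , 72 , 396 ] ∷ [ 12 , 63 , 90 , 396 ] ∷ [ 21 , 36 , 72 , 414 ]
  ∷ [ 10 , 57 , 90 , 414 ] ∷ [ 31 , 37 , 72 , 432 ] ∷ [ 4 , 66 , 90 , 432 ] ∷ [ 27 , 48 , 72 , 450 ]
  ∷ [ 3 , 64 , 90 , 450 ] ∷ [ 20 , 39 , 72 , 468 ] ∷ [ 16 , 71 , 90 , 468 ] ∷ [ 28 , 64 , 72 , 486 ]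
  ∷ [ 14 , 42 , 90 , 486 ] ∷ [ 34 , 68 , 72 , 504 ] ∷ [ 0 , 44 , 90 , 504 ] ∷ [ 19 , 69 , 72 , 522 ]
  ∷ [ 7 , 49 , 90 , 522 ] ∷ [ 25 , 54 , 72 , 540 ] ∷ [ 6 , 47 , 90 , 540 ] ∷ [ 32 , 59 , 72 , 558 ]
  ∷ [ 2 , 41 , 90 , 558 ] ∷ [ 52 , 70 , 72 , 576 ] ∷ [ 11 , 25 , 90 , 576 ] ∷ [ 47 , 62 , 72 , 594 ]
  ∷ [ 1 , 32 , 90 , 594 ] ∷ [ 46 , 58 , 72 , 612 ] ∷ [ 13 , 24 , 90 , 612 ] ∷ [ 50 , 56 , 72 , 630 ]
  ∷ [ 5 , 28 , 90 , 630 ] ∷ [ 51 , 71 , 72 , 648 ] ∷ [ 15 , 35 , 90 , 648 ] ∷ [])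

design-6-12 : Design (Fin ∘ size 6 12)
design-6-12 = DifferenceFamily.developed 18 (regular 18 (replicate 36 1))
  ( [ 0 , 21 , 52 , 64 ] ∷ [ 0 , 20 , 39 , 68 ] ∷ [ 0 , 22 , 38 , 69 ] ∷ [ 0 , 31 , 43 , 67 ]
  ∷ [ 0 , 28 , 45 , 70 ] ∷ [ 0 , 24 , 53 , 56 ] ∷ [ 13 , 31 , 72 , 108 ] ∷ [ 42 , 60 , 90 , 108 ]
  ∷ [ 6 , 23 , 72 , 126 ] ∷ [ 52 , 67 , 90 , 126 ] ∷ [ 11 , 25 , 72 , 144 ] ∷ [ 41 , 55 , 90 , 144 ]
  ∷ [ 3 , 33 , 72 , 162 ] ∷ [ 39 , 66 , 90 , 162 ] ∷ [ 15 , 22 , 72 , 180 ] ∷ [ 50 , 70 , 90 , 180 ]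
  ∷ [ 9 , 28 , 72 , 198 ] ∷ [ 44 , 63 , 90 , 198 ] ∷ [ 1 , 51 , 72 , 216 ] ∷ [ 19 , 54 , 90 , 216 ]
  ∷ [ 4 , 52 , 72 , 234 ] ∷ [ 24 , 57 , 90 , 234 ] ∷ [ 12 , 41 , 72 , 252 ] ∷ [ 18 , 62 , 90 , 252 ]
  ∷ [ 2 , 44 , 72 , 270 ] ∷ [ 25 , 65 , 90 , 270 ] ∷ [ 7 , 48 , 72 , 288 ] ∷ [ 32 , 71 , 90 , 288 ]
  ∷ [ 17 , 36 , 72 , 306 ] ∷ [ 23 , 61 , 90 , 306 ] ∷ [ 14 , 62 , 72 , 324 ] ∷ [ 28 , 43 , 90 , 324 ]
  ∷ [ 8 , 71 , 72 , 342 ] ∷ [ 22 , 36 , 90 , 342 ] ∷ [ 16 , 59 , 72 , 360 ] ∷ [ 29 , 38 , 90 , 360 ]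
  ∷ [ 5 , 64 , 72 , 378 ] ∷ [ 27 , 51 , 90 , 378 ] ∷ [ 10 , 68 , 72 , 396 ] ∷ [ 30 , 53 , 90 , 396 ]
  ∷ [ 0 , 57 , 72 , 414 ] ∷ [ 35 , 37 , 90 , 414 ] ∷ [ 21 , 39 , 72 , 432 ] ∷ [ 4 , 58 , 90 , 432 ]
  ∷ [ 32 , 42 , 72 , 450 ] ∷ [ 15 , 68 , 90 , 450 ] ∷ [ 30 , 38 , 72 , 468 ] ∷ [ 9 , 56 , 90 , 468 ]
  ∷ [ 18 , 43 , 72 , 486 ] ∷ [ 2 , 64 , 90 , 486 ] ∷ [ 27 , 49 , 72 , 504 ] ∷ [ 17 , 59 , 90 , 504 ]
  ∷ [ 26 , 47 , 72 , 522 ] ∷ [ 14 , 69 , 90 , 522 ] ∷ [ 29 , 63 , 72 , 540 ] ∷ [ 12 , 48 , 90 , 540 ]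
  ∷ [ 24 , 55 , 72 , 558 ] ∷ [ 7 , 40 , 90 , 558 ] ∷ [ 20 , 66 , 72 , 576 ] ∷ [ 16 , 47 , 90 , 576 ]
  ∷ [ 34 , 61 , 72 , 594 ] ∷ [ 3 , 49 , 90 , 594 ] ∷ [ 19 , 60 , 72 , 612 ] ∷ [ 1 , 45 , 90 , 612 ]
  ∷ [ 35 , 54 , 72 , 630 ] ∷ [ 6 , 46 , 90 , 630 ] ∷ [ 53 , 70 , 72 , 648 ] ∷ [ 10 , 26 , 90 , 648 ]
  ∷ [ 40 , 56 , 72 , 666 ] ∷ [ 0 , 33 , 90 , 666 ] ∷ [ 37 , 65 , 72 , 684 ] ∷ [ 5 , 34 , 90 , 684 ]
  ∷ [ 50 , 58 , 72 , 702 ] ∷ [ 11 , 20 , 90 , 702 ] ∷ [ 46 , 69 , 72 , 720 ] ∷ [ 13 , 21 , 90 , 720 ]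
  ∷ [ 45 , 67 , 72 , 738 ] ∷ [ 8 , 31 , 90 , 738 ] ∷ [])

-- Sufficiency for all a, by strong induction.

spectrum-1 : Spectrum 1
spectrum-1 1 _ _ = design-1-1
spectrum-1 2 _ _ = design-1-2
spectrum-1 0 () _
spectrum-1 (suc (suc (suc _))) _ (s≤s (s≤s ()))

spectrum-2 : Spectrum 2
spectrum-2 2 _ _ = design-2-2
spectrum-2 3 _ _ = design-2-3
spectrum-2 4 _ _ = design-2-4
spectrum-2 0 () _
spectrum-2 1 (s≤s ()) _
spectrum-2 (suc (suc (suc (suc (suc _))))) _ (s≤s (s≤s (s≤s (s≤s ()))))

spectrum-3 : Spectrum 3
spectrum-3 3 _ _ = design-3-3
spectrum-3 4 _ _ = design-3-4
spectrum-3 5 _ _ = design-3-5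
spectrum-3 6 _ _ = design-3-6
spectrum-3 0 () _
spectrum-3 1 (s≤s ()) _
spectrum-3 2 (s≤s (s≤s ())) _
spectrum-3 (suc (suc (suc (suc (suc (suc (suc _))))))) _ (s≤s (s≤s (s≤s (s≤s (s≤s (s≤s ()))))))

spectrum-4 : Spectrum 4
spectrum-4 4 _ _ = design-4-4
spectrum-4 5 _ _ = design-4-5
spectrum-4 6 _ _ = design-4-6
spectrum-4 7 _ _ = design-4-7
spectrum-4 8 _ _ = design-4-8
spectrum-4 0 () _
spectrum-4 1 (s≤s ()) _
spectrum-4 2 (s≤s (s≤s ())) _
spectrum-4 3 (s≤s (s≤s (s≤s ()))) _
spectrum-4 (suc (suc (suc (suc (suc (suc (suc (suc (suc _))))))))) _
  (s≤s (s≤s (s≤s (s≤s (s≤s (s≤s (s≤s (s≤s ()))))))))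

spectrum-6 : Spectrum 6
spectrum-6 6 _ _ = design-6-6
spectrum-6 7 _ _ = design-6-7
spectrum-6 8 _ _ = design-6-8
spectrum-6 9 _ _ = design-6-9
spectrum-6 10 _ _ = design-6-10
spectrum-6 11 _ _ = design-6-11
spectrum-6 12 _ _ = design-6-12
spectrum-6 0 () _
spectrum-6 1 (s≤s ()) _
spectrum-6 2 (s≤s (s≤s ())) _
spectrum-6 3 (s≤s (s≤s (s≤s ()))) _
spectrum-6 4 (s≤s (s≤s (s≤s (s≤s ())))) _
spectrum-6 5 (s≤s (s≤s (s≤s (s≤s (s≤s ()))))) _
spectrum-6 (suc (suc (suc (suc (suc (suc (suc (suc (suc (suc (suc (suc (suc _))))))))))))) _
  (s≤s (s≤s (s≤s (s≤s (s≤s (s≤s (s≤s (s≤s (s≤s (s≤s (s≤s (s≤s ()))))))))))))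

private
  coprime-part : ∀ {r} q → 1 ≤ q → Spectrum r → 2 ∤ q → 3 ∤ q → Spectrum (q * r)
  coprime-part q 1≤q S 2∤q 3∤q = spectrum-* (cyclicTD6 q {{>-nonZero 1≤q}} 2∤q 3∤q) S

  quotient-positive : ∀ q {r} → 1 ≤ q * r → 1 ≤ q
  quotient-positive (suc q) _ = s≤s z≤n

  quotient-< : ∀ q r → 1 ≤ q * suc (suc r) → q < q * suc (suc r)
  quotient-< q r 1≤ = ℕ.m<m*n q (suc (suc r)) {{>-nonZero (quotient-positive q 1≤)}} (s≤s (s≤s z≤n))

spectrum : ∀ a → 1 ≤ a → Spectrum a
spectrum = <-rec _ step
  where
  step : ∀ a → (∀ {q} → q < a → 1 ≤ q → Spectrum q) → 1 ≤ a → Spectrum a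
  step a rec 1≤a with 8 ∣? a
  ... | yes (divides q refl) = subst Spectrum (ℕ.*-comm 8 q)
          (spectrum-* TD6-8 (rec (quotient-< q 6 1≤a) (quotient-positive q 1≤a)))
  ... | no 8∤a with 9 ∣? a
  ...   | yes (divides q refl) = subst Spectrum (ℕ.*-comm 9 q)
            (spectrum-* TD6-9 (rec (quotient-< q 7 1≤a) (quotient-positive q 1≤a)))
  ...   | no 9∤a with 12 ∣? a
  ...     | yes (divides q refl) = subst Spectrum (ℕ.*-comm 12 q)
              (spectrum-* TD6-12 (rec (quotient-< q 10 1≤a) (quotient-positive q 1≤a)))
  -- In every case the cofactor is prime to 6: a factor 2 or 3 in it would make a divisible by one
  -- of the numbers already excluded.
  ...     | no 12∤a with 4 ∣? a | 6 ∣? a | 3 ∣? a | 2 ∣? a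
  ...       | yes (divides q refl) | _ | _ | _ =
                coprime-part q (quotient-positive q 1≤a) spectrum-4
                  (λ 2∣q → 8∤a (*-monoˡ-∣ 4 2∣q)) (λ 3∣q → 12∤a (*-monoˡ-∣ 4 3∣q))
  ...       | no _ | yes (divides q refl) | _ | _ =
                coprime-part q (quotient-positive q 1≤a) spectrum-6
                  (λ 2∣q → 12∤a (*-monoˡ-∣ 6 2∣q)) (λ 3∣q → 9∤a (∣-trans (divides 2 refl) (*-monoˡ-∣ 6 3∣q)))
  ...       | no _ | no 6∤a | yes (divides q refl) | _ =
                coprime-part q (quotient-positive q 1≤a) spectrum-3
                  (λ 2∣q → 6∤a (*-monoˡ-∣ 3 2∣q)) (λ 3∣q → 9∤a (*-monoˡ-∣ 3 3∣q))
  ...       | no 4∤a | no 6∤a | no _ | yes (divides q refl) =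
                coprime-part q (quotient-positive q 1≤a) spectrum-2
                  (λ 2∣q → 4∤a (*-monoˡ-∣ 2 2∣q)) (λ 3∣q → 6∤a (*-monoˡ-∣ 2 3∣q))
  ...       | no _ | no _ | no 3∤a | no 2∤a =
                subst Spectrum (ℕ.*-identityʳ a) (coprime-part a 1≤a spectrum-1 2∤a 3∤a)

theorem3p2 : (a b : ℕ) → 1 ≤ a → 1 ≤ b →
    (GDD4 (typeThm a b) ⇔ (a ≤ b × b ≤ 2 * a))
theorem3p2 a b 1≤a 1≤b = mk⇔ (necessity a b 1≤a)
  (λ (a≤b , b≤2a) → toGDD4 1≤a (spectrum a 1≤a b a≤b b≤2a))
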